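{- Let $R$ be a ring and let $A$, $B$, $C'$ be $n\times n$ matrices over $R$. Suppose that $C'$ differs from the matrix product $C=A\times B$ in at most $k$ entries. Then there is a deterministic algorithm that, given $A$, $B$, $C'$ and $k$, identifies these erroneous entries and corrects them (outputting $C$) in $\tilde{O}(kn^2)$ time.
   Context: Running time is measured in a unit-cost model where each ring operation and elementary operation costs $O(1)$; $\tilde{O}$ suppresses factors polylogarithmic in $n$ and $k$. -}

module Defs where

open import Algebra.Bundles using (Ring)
import Algebra.Properties.Semiring.Sum as SemiringSum
open import Data.Bool.Base using (Bool; true; false; if_then_else_; _∧_)
open import Data.Fin.Base using (Fin; toℕ; fromℕ<)
open import Data.List.Base using (List; map; filter; allFin; upTo; cartesianProduct)
open import Data.List.Relation.Binary.Permutation.Propositional using (_↭_)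
open import Data.Nat.Base using (ℕ; _+_; _*_; _∸_; _^_; _⊔_; _≤_; _≡ᵇ_; _<ᵇ_)
open import Data.Nat.Logarithm using (⌊log₂_⌋)
open import Data.Nat.Properties using (_<?_)
open import Data.Product.Base using (_×_; _,_; ∃-syntax)
open import Data.Vec.Functional using (Vector)
open import Relation.Binary.Definitions using (Decidable)
open import Relation.Binary.PropositionalEquality using (_≡_; refl; sym; trans)
open import Relation.Nullary.Decidable using (does; yes; no; ¬?)

-- Some computation step is always needed, so the bound is read with
-- 1 ⊔ g; this matters only where g vanishes.
infix 4 _∈Õ_
_∈Õ_ : (ℕ → ℕ → ℕ) → (ℕ → ℕ → ℕ) → Set
f ∈Õ g = ∃[ c ] ∃[ d ] ∀ n k →
  f n k ≤ c * (1 + ⌊log₂ n ⌋ + ⌊log₂ k ⌋) ^ d * (1 ⊔ g n k)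

-- Programs for a uniform-cost random access machine with additive
-- arithmetic on natural numbers (indices, counters) and the ring
-- operations, including the equality test, on ring elements.  Storage
-- consists of integer variables and of two-dimensional integer and ring
-- arrays, each with a name in ℕ fixed in the program text.  Indices are
-- computed, so arrays provide indirect addressing.  The syntax does not
-- mention the ring, and ring elements cannot be converted to integers.

infixl 6 _⊕_ _⊖_
data IntExp : Set where
  lit       : ℕ → IntExp
  var       : ℕ → IntExp
  int_[_,_] : ℕ → IntExp → IntExp → IntExp
  _⊕_ _⊖_   : IntExp → IntExp → IntExp

infixl 6 _⊞_
infixl 7 _⊠_
data RingExp : Set where
  𝟘 𝟙        : RingExp
  ring_[_,_] : ℕ → IntExp → IntExp → RingExp
  _⊞_ _⊠_    : RingExp → RingExp → RingExp
  ⊟_         : RingExp → RingExp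

infix 4 _<'_ _≡'_ _≈'_
data Test : Set where
  _<'_ _≡'_ : IntExp → IntExp → Test
  _≈'_      : RingExp → RingExp → Test

infixr 2 _︔_
infix  3 _≔_ int_[_,_]≔_ ring_[_,_]≔_
data Program : Set where
  skip          : Program
  _≔_           : ℕ → IntExp → Program
  int_[_,_]≔_   : ℕ → IntExp → IntExp → IntExp → Program
  ring_[_,_]≔_  : ℕ → IntExp → IntExp → RingExp → Program
  _︔_           : Program → Program → Program
  If_Then_Else_ : Test → Program → Program → Program
  While_Do_     : Test → Program → Program

-- Costs charge one unit for every constant, memory access, arithmetic or
-- ring operation, and comparison.

costᴵ : IntExp → ℕ
costᴵ (lit _)           = 1
costᴵ (var _)           = 1
costᴵ (int _ [ e , f ]) = 1 + costᴵ e + costᴵ f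
costᴵ (e ⊕ f)           = 1 + costᴵ e + costᴵ f
costᴵ (e ⊖ f)           = 1 + costᴵ e + costᴵ f

costᴿ : RingExp → ℕ
costᴿ 𝟘                  = 1
costᴿ 𝟙                  = 1
costᴿ (ring _ [ e , f ]) = 1 + costᴵ e + costᴵ f
costᴿ (x ⊞ y)            = 1 + costᴿ x + costᴿ y
costᴿ (x ⊠ y)            = 1 + costᴿ x + costᴿ y
costᴿ (⊟ x)              = 1 + costᴿ x

costᵀ : Test → ℕ
costᵀ (e <' f) = 1 + costᴵ e + costᴵ f
costᵀ (e ≡' f) = 1 + costᴵ e + costᴵ f
costᵀ (x ≈' y) = 1 + costᴿ x + costᴿ y

Arrays : ∀ {a} → Set a → Set a
Arrays X = ℕ → ℕ → ℕ → X

updateVar : (ℕ → ℕ) → ℕ → ℕ → (ℕ → ℕ)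
updateVar vs x v y = if y ≡ᵇ x then v else vs y

updateArr : ∀ {a} {X : Set a} → Arrays X → ℕ → ℕ → ℕ → X → Arrays X
updateArr m a i j v a′ i′ j′ =
  if (a′ ≡ᵇ a) ∧ (i′ ≡ᵇ i) ∧ (j′ ≡ᵇ j) then v else m a′ i′ j′

-- The machine's equality test on ring elements is a parameter.

module OverRing {r ℓ} (R : Ring r ℓ) (_≟_ : Decidable (Ring._≈_ R)) where

  open Ring R using (Carrier; _≈_; 0#; 1#; semiring)
    renaming (_+_ to _+ᴿ_; _*_ to _*ᴿ_; -_ to -ᴿ_)
  open SemiringSum semiring using (sum)

  Matrix : ℕ → Set r
  Matrix n = Vector (Vector Carrier n) n

  infixl 7 _⊗_
  _⊗_ : ∀ {n} → Matrix n → Matrix n → Matrix n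
  (A ⊗ B) i j = sum λ l → A i l *ᴿ B l j

  differences : ∀ {n} → Matrix n → Matrix n → List (Fin n × Fin n)
  differences {n} M N =
    filter (λ (i , j) → ¬? (M i j ≟ N i j)) (cartesianProduct (allFin n) (allFin n))

  record State : Set r where
    constructor state
    field
      vars  : ℕ → ℕ
      ints  : Arrays ℕ
      rings : Arrays Carrier
  open State public

  ⟦_⟧ᴵ : IntExp → State → ℕ
  ⟦ lit m ⟧ᴵ           s = m
  ⟦ var x ⟧ᴵ           s = vars s x
  ⟦ int a [ e , f ] ⟧ᴵ s = ints s a (⟦ e ⟧ᴵ s) (⟦ f ⟧ᴵ s)
  ⟦ e ⊕ f ⟧ᴵ           s = ⟦ e ⟧ᴵ s + ⟦ f ⟧ᴵ s
  ⟦ e ⊖ f ⟧ᴵ           s = ⟦ e ⟧ᴵ s ∸ ⟦ f ⟧ᴵ s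

  ⟦_⟧ᴿ : RingExp → State → Carrier
  ⟦ 𝟘 ⟧ᴿ                s = 0#
  ⟦ 𝟙 ⟧ᴿ                s = 1#
  ⟦ ring a [ e , f ] ⟧ᴿ s = rings s a (⟦ e ⟧ᴵ s) (⟦ f ⟧ᴵ s)
  ⟦ x ⊞ y ⟧ᴿ            s = ⟦ x ⟧ᴿ s +ᴿ ⟦ y ⟧ᴿ s
  ⟦ x ⊠ y ⟧ᴿ            s = ⟦ x ⟧ᴿ s *ᴿ ⟦ y ⟧ᴿ s
  ⟦ ⊟ x ⟧ᴿ              s = -ᴿ ⟦ x ⟧ᴿ s

  ⟦_⟧ᵀ : Test → State → Bool
  ⟦ e <' f ⟧ᵀ s = ⟦ e ⟧ᴵ s <ᵇ ⟦ f ⟧ᴵ s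
  ⟦ e ≡' f ⟧ᵀ s = ⟦ e ⟧ᴵ s ≡ᵇ ⟦ f ⟧ᴵ s
  ⟦ x ≈' y ⟧ᵀ s = does (⟦ x ⟧ᴿ s ≟ ⟦ y ⟧ᴿ s)

  -- P ⊢ s ⇓[ t ] s′ : started in s, P halts in s′ after time t.
  infix 1 _⊢_⇓[_]_
  data _⊢_⇓[_]_ : Program → State → ℕ → State → Set r where
    ⇓skip : ∀ {s} → skip ⊢ s ⇓[ 0 ] s
    ⇓var : ∀ {s x e} →
      x ≔ e ⊢ s ⇓[ 1 + costᴵ e ]
      state (updateVar (vars s) x (⟦ e ⟧ᴵ s)) (ints s) (rings s)
    ⇓int : ∀ {s a e f g} →
      int a [ e , f ]≔ g ⊢ s ⇓[ 1 + costᴵ e + costᴵ f + costᴵ g ]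
      state (vars s) (updateArr (ints s) a (⟦ e ⟧ᴵ s) (⟦ f ⟧ᴵ s) (⟦ g ⟧ᴵ s)) (rings s)
    ⇓ring : ∀ {s a e f x} →
      ring a [ e , f ]≔ x ⊢ s ⇓[ 1 + costᴵ e + costᴵ f + costᴿ x ]
      state (vars s) (ints s) (updateArr (rings s) a (⟦ e ⟧ᴵ s) (⟦ f ⟧ᴵ s) (⟦ x ⟧ᴿ s))
    ⇓seq : ∀ {P Q s s′ s″ t u} →
      P ⊢ s ⇓[ t ] s′ → Q ⊢ s′ ⇓[ u ] s″ → (P ︔ Q) ⊢ s ⇓[ t + u ] s″
    ⇓then : ∀ {b P Q s s′ t} → ⟦ b ⟧ᵀ s ≡ true →
      P ⊢ s ⇓[ t ] s′ → If b Then P Else Q ⊢ s ⇓[ costᵀ b + t ] s′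
    ⇓else : ∀ {b P Q s s′ t} → ⟦ b ⟧ᵀ s ≡ false →
      Q ⊢ s ⇓[ t ] s′ → If b Then P Else Q ⊢ s ⇓[ costᵀ b + t ] s′
    ⇓stop : ∀ {b P s} → ⟦ b ⟧ᵀ s ≡ false →
      While b Do P ⊢ s ⇓[ costᵀ b ] s
    ⇓loop : ∀ {b P s s′ s″ t u} → ⟦ b ⟧ᵀ s ≡ true →
      P ⊢ s ⇓[ t ] s′ → While b Do P ⊢ s′ ⇓[ u ] s″ →
      While b Do P ⊢ s ⇓[ costᵀ b + t + u ] s″

  ⇓-deterministic : ∀ {P s t t′ s′ s″} →
    P ⊢ s ⇓[ t ] s′ → P ⊢ s ⇓[ t′ ] s″ → t ≡ t′ × s′ ≡ s″
  ⇓-deterministic ⇓skip ⇓skip = refl , refl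
  ⇓-deterministic ⇓var  ⇓var  = refl , refl
  ⇓-deterministic ⇓int  ⇓int  = refl , refl
  ⇓-deterministic ⇓ring ⇓ring = refl , refl
  ⇓-deterministic (⇓seq p q) (⇓seq p′ q′) with ⇓-deterministic p p′
  ... | refl , refl with ⇓-deterministic q q′
  ...   | refl , refl = refl , refl
  ⇓-deterministic (⇓then _ p) (⇓then _ p′) with ⇓-deterministic p p′
  ... | refl , refl = refl , refl
  ⇓-deterministic (⇓then h _) (⇓else h′ _) with trans (sym h) h′
  ... | ()
  ⇓-deterministic (⇓else h _) (⇓then h′ _) with trans (sym h) h′
  ... | ()
  ⇓-deterministic (⇓else _ p) (⇓else _ p′) with ⇓-deterministic p p′
  ... | refl , refl = refl , refl
  ⇓-deterministic (⇓stop _) (⇓stop _) = refl , refl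
  ⇓-deterministic (⇓stop h) (⇓loop h′ _ _) with trans (sym h) h′
  ... | ()
  ⇓-deterministic (⇓loop h _ _) (⇓stop h′) with trans (sym h) h′
  ... | ()
  ⇓-deterministic (⇓loop _ p q) (⇓loop _ p′ q′) with ⇓-deterministic p p′
  ... | refl , refl with ⇓-deterministic q q′
  ...   | refl , refl = refl , refl

  entry : ∀ {n} → Matrix n → ℕ → ℕ → Carrier
  entry {n} M i j with i <? n | j <? n
  ... | yes i<n | yes j<n = M (fromℕ< i<n) (fromℕ< j<n)
  ... | _       | _       = 0#

  -- n and k are in variables 0 and 1, and A, B, C′ in ring arrays 0, 1, 2;
  -- all other storage is zero.
  input : ∀ {n} → ℕ → (A B C′ : Matrix n) → State
  input {n} k A B C′ = state vs (λ _ _ _ → 0) rs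
    where
    vs : ℕ → ℕ
    vs 0 = n
    vs 1 = k
    vs _ = 0
    rs : Arrays Carrier
    rs 0 = entry A
    rs 1 = entry B
    rs 2 = entry C′
    rs _ = λ _ _ → 0#

  -- The matrix is corrected in place, in ring array 2.
  HoldsMatrix : ∀ {n} → State → Matrix n → Set ℓ
  HoldsMatrix s M = ∀ i j → rings s 2 (toℕ i) (toℕ j) ≈ M i j

  -- Variable 2 holds the length of the list of reported positions; row l of
  -- integer array 0 holds the coordinates of the l-th one.
  reported : State → List (ℕ × ℕ)
  reported s = map (λ l → ints s 0 l 0 , ints s 0 l 1) (upTo (vars s 2))

  -- Each position is reported exactly once, in any order.
  Reports : ∀ {n} → State → List (Fin n × Fin n) → Set
  Reports s ps = reported s ↭ map (λ (i , j) → toℕ i , toℕ j) ps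

{-# OPTIONS --safe #-}
module Submission where

-- Let s = ⌊√k⌋ and let M be of order s log n.  For every modulus m < M and residue r < M
-- let χ be the indicator vector of {j : j mod m = r}, and compare A (B χ) with C′ χ; a row
-- where they differ contains an error and is recomputed from scratch.  This happens to at
-- most k rows, at O(n²) each, and the tests take O(M² n²) = Õ(k n²).
--
-- A row with between 1 and s errors fails some test: if j₀ is an error and no m < M
-- separates j₀ from the other errors j, then every m < M divides Π |j − j₀| ≤ n ^ s, whereas a
-- positive common multiple of 1, …, M − 1 is exponential in M.  Hence the rows that are still
-- wrong have more than s errors each, there are at most s of them, every column has at
-- most s errors left, and the same procedure applied to the columns removes those.

open import Defs
open import Algebra.Bundles using (Ring)
import Algebra.Properties.Group as GroupProperties
import Algebra.Properties.Semiring.Sum as SemiringSum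
open import Data.Bool.Base using (Bool; true; false; if_then_else_; T; not; _∨_)
open import Data.Empty using (⊥-elim)
open import Data.Fin.Base using (Fin; toℕ)
open import Data.Fin.Properties using (toℕ<n; fromℕ<-toℕ; toℕ-inject₁; toℕ-fromℕ)
open import Data.List.Base using (List; []; _∷_; [_]; _++_; length; map; filter; upTo; applyUpTo; allFin; tabulate; cartesianProduct)
open import Data.List.Membership.Propositional using (_∈_)
open import Data.List.Membership.Propositional.Properties using (∈-filter⁺; ∈-cartesianProduct⁺; ∈-allFin)
open import Data.List.Properties using (map-tabulate; map-++; map-∘; map-upTo; ++-assoc; ++-identityʳ; filter-++; upTo-∷ʳ; applyUpTo-∷ʳ; cartesianProductWith-distribʳ-++; length-++; length-map)
open import Data.List.Relation.Binary.Permutation.Propositional using (↭-reflexive)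
open import Data.Nat.Base
open import Data.Nat.Logarithm using (⌊log₂_⌋; ⌊log₂⌋-mono-≤; ⌊log₂[2*b]⌋≡1+⌊log₂b⌋; ⌊log₂[2^n]⌋≡n)
open import Data.Nat.Properties as ℕ using (m<n⇒m<1+n; n<1+n; m≤n⇒m<n∨m≡n; <⇒≢; <⇒≤; ≤-refl; ≤-trans; ≤-reflexive; +-mono-≤; +-monoˡ-≤; +-monoʳ-≤; *-monoˡ-≤; *-monoʳ-≤; *-mono-≤; ≡⇒≡ᵇ; ≡ᵇ⇒≡; <-trans; _<?_; _≤?_; ≤ᵇ⇒≤; module ≤-Reasoning)
open import Data.Nat.Tactic.RingSolver using (solve-∀)
open import Data.Product.Base using (_×_; _,_; ∃-syntax; proj₁; proj₂)
open import Data.Sum.Base using (_⊎_; inj₁; inj₂)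
open import Function.Base using (_∘_; id)
open import Level using () renaming (_⊔_ to _⊔ˡ_)
open import Relation.Binary.Definitions using (Decidable)
open import Relation.Binary.PropositionalEquality as ≡ using (_≡_; _≢_; cong; cong₂; subst)
open import Relation.Nullary using (¬_; Dec; does; yes; no; ¬?)
open import Relation.Unary using (Pred) renaming (Decidable to Decidable₁)

-- The time bound forces M to be about √k: trying all pairs (m, r) costs M² tests of O(n²) each, and
-- isolating an error among up to k others in its row would take M of order k log n, hence time
-- about k² n². Isolation is therefore demanded only in rows with at most √k errors, and the second
-- direction exists to finish the heavy ones. The size of M comes from comparing two exponents. The
-- product of distances is at most 2 ^ (s L) when n ≤ 2 ^ L, while a positive common multiple of 1,
-- ..., 2 h + 1 is at least 2 ^ h, being divisible by (2 h + 1) C(2 h, h); taking h = s L + 1 gives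
-- the contradiction. The column phase is the row phase for Bᵀ, Aᵀ and C′ᵀ over the opposite ring. A
-- Boolean orientation selects between the two, in the program text as well as in the algebra, so
-- that each argument is made once. The machine's integer arithmetic is additive, so residues,
-- powers of 2 and squares are maintained incrementally by loops of length n or k.

module Arithmetic where

  open import Data.Nat.Combinatorics using (_C_; nCk+nC[k+1]≡[n+1]C[k+1]; nC1≡n; k>n⇒nCk≡0)
  open import Data.Nat.Divisibility
  open import Data.Nat.Properties
  open ≡ using (refl; sym; trans; module ≡-Reasoning)

  -- Binomial coefficients and the growth of common multiples.

  nC0≡1 : ∀ n → n C 0 ≡ 1
  nC0≡1 zero = refl
  nC0≡1 (suc n) = refl

  C-absorb : ∀ n k → suc k * (suc n C suc k) ≡ suc n * (n C k)
  C-absorb zero zero = refl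
  C-absorb zero (suc k) = trans
    (cong (suc (suc k) *_) (k>n⇒nCk≡0 {1} {suc (suc k)} (s≤s (s≤s z≤n))))
    (trans (*-zeroʳ (suc (suc k))) (sym (cong (1 *_) (k>n⇒nCk≡0 {0} {suc k} (s≤s z≤n)))))
  C-absorb (suc n) zero = begin
    1 * (suc (suc n) C 1)       ≡⟨ *-identityˡ _ ⟩
    suc (suc n) C 1             ≡⟨ nC1≡n (suc (suc n)) ⟩
    suc (suc n)                 ≡⟨ *-identityʳ _ ⟨
    suc (suc n) * 1             ≡⟨ cong (suc (suc n) *_) (nC0≡1 (suc n)) ⟨
    suc (suc n) * (suc n C 0)   ∎
    where open ≡-Reasoning
  C-absorb (suc n) (suc k) = begin
    suc (suc k) * (suc (suc n) C suc (suc k))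
      ≡⟨ cong (suc (suc k) *_) (nCk+nC[k+1]≡[n+1]C[k+1] (suc n) (suc k)) ⟨
    suc (suc k) * ((suc n C suc k) + (suc n C suc (suc k)))
      ≡⟨ *-distribˡ-+ (suc (suc k)) (suc n C suc k) _ ⟩
    (suc n C suc k) + suc k * (suc n C suc k) + suc (suc k) * (suc n C suc (suc k))
      ≡⟨ cong₂ (λ x y → (suc n C suc k) + x + y) (C-absorb n k) (C-absorb n (suc k)) ⟩
    (suc n C suc k) + suc n * (n C k) + suc n * (n C suc k)
      ≡⟨ +-assoc (suc n C suc k) (suc n * (n C k)) (suc n * (n C suc k)) ⟩
    (suc n C suc k) + (suc n * (n C k) + suc n * (n C suc k))
      ≡⟨ cong ((suc n C suc k) +_) (*-distribˡ-+ (suc n) (n C k) (n C suc k)) ⟨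
    (suc n C suc k) + suc n * ((n C k) + (n C suc k))
      ≡⟨ cong (λ x → (suc n C suc k) + suc n * x) (nCk+nC[k+1]≡[n+1]C[k+1] n k) ⟩
    suc (suc n) * (suc n C suc k) ∎
    where open ≡-Reasoning

  C-mono-n : ∀ n k → n C k ≤ suc n C k
  C-mono-n n zero = ≤-reflexive (trans (nC0≡1 n) (sym (nC0≡1 (suc n))))
  C-mono-n n (suc k) = ≤-trans (m≤n+m (n C suc k) (n C k))
    (≤-reflexive (nCk+nC[k+1]≡[n+1]C[k+1] n k))

  C-mono-diag : ∀ n k → n C k ≤ suc n C suc k
  C-mono-diag n k = ≤-trans (m≤m+n (n C k) (n C suc k))
    (≤-reflexive (nCk+nC[k+1]≡[n+1]C[k+1] n k))

  -- By Pascal's rule the next central coefficient is a sum of two entries, each at least the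
  -- previous central coefficient, so it at least doubles.
  2^h≤2hCh : ∀ h → 2 ^ h ≤ (h + h) C h
  2^h≤2hCh zero = ≤-refl
  2^h≤2hCh (suc h) = begin
    2 ^ h + (2 ^ h + 0)
      ≡⟨ cong (2 ^ h +_) (+-identityʳ (2 ^ h)) ⟩
    2 ^ h + 2 ^ h
      ≤⟨ +-mono-≤ (≤-trans (2^h≤2hCh h) (C-mono-n (h + h) h))
                  (≤-trans (2^h≤2hCh h) (C-mono-diag (h + h) h)) ⟩
    (suc (h + h) C h) + (suc (h + h) C suc h)
      ≡⟨ nCk+nC[k+1]≡[n+1]C[k+1] (suc (h + h)) h ⟩
    suc (suc (h + h)) C suc h
      ≡⟨ cong (λ x → suc x C suc h) (+-suc h h) ⟨
    (suc h + suc h) C suc h ∎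
    where open ≤-Reasoning

  -- Leibniz's harmonic triangle: the reciprocals of a(n,k) = (n+1) C(n,k) satisfy
  -- 1/a(n+1,k+1) = 1/a(n,k) − 1/a(n+1,k), so N/a(n,k) is an integer by
  -- induction on k.
  leibniz-∣ : ∀ {N M} → (∀ m → 1 ≤ m → m < M → m ∣ N) →
    ∀ k n → k ≤ n → suc n < M → suc n * (n C k) ∣ N
  leibniz-∣ {N} H zero n _ n<M =
    subst (_∣ N) (sym (trans (cong (suc n *_) (nC0≡1 n)) (*-identityʳ (suc n)))) (H (suc n) (s≤s z≤n) n<M)
  leibniz-∣ {N} {M} H (suc k) (suc n) (s≤s k≤n) n<M
    with leibniz-∣ H k n k≤n (<-trans (n<1+n _) n<M) | leibniz-∣ H k (suc n) (m≤n⇒m≤1+n k≤n) n<M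
  -- The quotient is x - y because 1/a(n+1,k+1) is a difference of reciprocals. The truncated
  -- subtraction is exact: `scaled`, with k + 1 cancelled, says x a(n+1,k+1) = N + y a(n+1,k+1).
  ... | divides x N≡xP | divides y N≡yW = divides (x ∸ y) (sym (begin
    (x ∸ y) * (suc (suc n) * c₁)
      ≡⟨ *-distribʳ-∸ (suc (suc n) * c₁) x y ⟩
    x * (suc (suc n) * c₁) ∸ y * (suc (suc n) * c₁)
      ≡⟨ cong (_∸ y * (suc (suc n) * c₁)) (*-cancelˡ-≡ _ _ (suc k) scaled) ⟩
    N + y * (suc (suc n) * c₁) ∸ y * (suc (suc n) * c₁)
      ≡⟨ m+n∸n≡m N (y * (suc (suc n) * c₁)) ⟩
    N ∎))
    where
    open ≡-Reasoning
    c₀ = n C k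
    c₁ = suc n C suc k
    w = suc n C k
    absorb₀ : suc k * c₁ ≡ suc n * c₀
    absorb₀ = C-absorb n k
    absorb₁ : suc k * (w + c₁) ≡ suc (suc n) * w
    absorb₁ = trans (cong (suc k *_) (nCk+nC[k+1]≡[n+1]C[k+1] (suc n) k)) (C-absorb (suc n) k)
    rearr₁ : ∀ p q r v → p * (v * (q * r)) ≡ q * (v * (p * r))
    rearr₁ = solve-∀
    rearr₂ : ∀ p q r u v → q * (v * (p * r)) + p * (v * (q * u)) ≡ q * (v * (p * (u + r)))
    rearr₂ = solve-∀
    left : suc k * (x * (suc (suc n) * c₁)) ≡ suc (suc n) * N
    left = begin
      suc k * (x * (suc (suc n) * c₁))   ≡⟨ rearr₁ (suc k) (suc (suc n)) c₁ x ⟩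
      suc (suc n) * (x * (suc k * c₁))   ≡⟨ cong (λ z → suc (suc n) * (x * z)) absorb₀ ⟩
      suc (suc n) * (x * (suc n * c₀))   ≡⟨ cong (suc (suc n) *_) N≡xP ⟨
      suc (suc n) * N                    ∎
    right : suc k * (N + y * (suc (suc n) * c₁)) ≡ suc (suc n) * N
    right = begin
      suc k * (N + y * (suc (suc n) * c₁))
        ≡⟨ *-distribˡ-+ (suc k) N _ ⟩
      suc k * N + suc k * (y * (suc (suc n) * c₁))
        ≡⟨ cong₂ _+_ (cong (suc k *_) N≡yW) (rearr₁ (suc k) (suc (suc n)) c₁ y) ⟩
      suc k * (y * (suc (suc n) * w)) + suc (suc n) * (y * (suc k * c₁))
        ≡⟨ +-comm (suc k * (y * (suc (suc n) * w))) _ ⟩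
      suc (suc n) * (y * (suc k * c₁)) + suc k * (y * (suc (suc n) * w))
        ≡⟨ rearr₂ (suc k) (suc (suc n)) c₁ w y ⟩
      suc (suc n) * (y * (suc k * (w + c₁)))
        ≡⟨ cong (λ z → suc (suc n) * (y * z)) absorb₁ ⟩
      suc (suc n) * (y * (suc (suc n) * w))
        ≡⟨ cong (suc (suc n) *_) N≡yW ⟨
      suc (suc n) * N ∎
    scaled : suc k * (x * (suc (suc n) * c₁)) ≡ suc k * (N + y * (suc (suc n) * c₁))
    scaled = trans left (sym right)

  -- The central entry (2 h + 1) C(2 h, h) of the triangle divides N, and row 2 h of the triangle
  -- uses only the divisors up to 2 h + 1; hence the range m < 2 + 2 h.
  common-multiple-≥2^ : ∀ {N} h → 1 ≤ N →
    (∀ m → 1 ≤ m → m < 2 + (h + h) → m ∣ N) → 2 ^ h ≤ N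
  common-multiple-≥2^ {N} h 1≤N H = ≤-trans (2^h≤2hCh h) (≤-trans (m≤n*m _ (suc (h + h)))
    (∣⇒≤ {{>-nonZero 1≤N}} (leibniz-∣ H h (h + h) (m≤m+n h h) ≤-refl)))

  -- Finite sums and products, residues, and the isolating modulus.

  sumᴺ prodᴺ : ℕ → (ℕ → ℕ) → ℕ
  sumᴺ zero f = 0
  sumᴺ (suc n) f = sumᴺ n f + f n
  prodᴺ zero f = 1
  prodᴺ (suc n) f = prodᴺ n f * f n

  sumᴺ-mono : ∀ n {f g} → (∀ i → i < n → f i ≤ g i) → sumᴺ n f ≤ sumᴺ n g
  sumᴺ-mono zero h = z≤n
  sumᴺ-mono (suc n) h = +-mono-≤ (sumᴺ-mono n (λ i i<n → h i (m<n⇒m<1+n i<n))) (h n (n<1+n n))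

  sumᴺ-+ : ∀ n f g → sumᴺ n (λ i → f i + g i) ≡ sumᴺ n f + sumᴺ n g
  sumᴺ-+ zero f g = refl
  sumᴺ-+ (suc n) f g = trans (cong (_+ (f n + g n)) (sumᴺ-+ n f g))
    (+-interchange (sumᴺ n f) (sumᴺ n g) (f n) (g n))
    where
    +-interchange : ∀ a b c d → a + b + (c + d) ≡ a + c + (b + d)
    +-interchange = solve-∀

  sumᴺ-const : ∀ n c → sumᴺ n (λ _ → c) ≡ n * c
  sumᴺ-const zero c = refl
  sumᴺ-const (suc n) c = trans (cong (_+ c) (sumᴺ-const n c)) (+-comm (n * c) c)

  sumᴺ-*ˡ : ∀ n c f → sumᴺ n (λ i → c * f i) ≡ c * sumᴺ n f
  sumᴺ-*ˡ zero c f = sym (*-zeroʳ c)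
  sumᴺ-*ˡ (suc n) c f = trans (cong (_+ c * f n) (sumᴺ-*ˡ n c f)) (sym (*-distribˡ-+ c (sumᴺ n f) (f n)))

  sumᴺ-comm : ∀ m n (f : ℕ → ℕ → ℕ) →
    sumᴺ m (λ i → sumᴺ n (λ j → f i j)) ≡ sumᴺ n (λ j → sumᴺ m (λ i → f i j))
  sumᴺ-comm zero n f = sym (trans (sumᴺ-const n 0) (*-zeroʳ n))
  sumᴺ-comm (suc m) n f = trans (cong (_+ sumᴺ n (f m)) (sumᴺ-comm m n f))
    (sym (sumᴺ-+ n (λ j → sumᴺ m (λ i → f i j)) (f m)))

  term≤sumᴺ : ∀ n f {j} → j < n → f j ≤ sumᴺ n f
  term≤sumᴺ (suc n) f {j} j<1+n with m≤n⇒m<n∨m≡n (s≤s⁻¹ j<1+n)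
  ... | inj₁ j<n = ≤-trans (term≤sumᴺ n f j<n) (m≤m+n _ _)
  ... | inj₂ refl = m≤n+m _ _

  factor-∣-prodᴺ : ∀ n f {j} → j < n → f j ∣ prodᴺ n f
  factor-∣-prodᴺ (suc n) f {j} j<1+n with m≤n⇒m<n∨m≡n (s≤s⁻¹ j<1+n)
  ... | inj₁ j<n = ∣m⇒∣m*n (f n) (factor-∣-prodᴺ n f j<n)
  ... | inj₂ refl = n∣m*n (prodᴺ n f)

  prodᴺ-≥1 : ∀ n f → (∀ j → 1 ≤ f j) → 1 ≤ prodᴺ n f
  prodᴺ-≥1 zero f h = ≤-refl
  prodᴺ-≥1 (suc n) f h = *-mono-≤ (prodᴺ-≥1 n f h) (h n)

  prodᴺ-≤-^ : ∀ n b f e → (∀ j → j < n → f j ≤ b ^ e j) → prodᴺ n f ≤ b ^ sumᴺ n e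
  prodᴺ-≤-^ zero b f e h = ≤-refl
  prodᴺ-≤-^ (suc n) b f e h = ≤-trans
    (*-mono-≤ (prodᴺ-≤-^ n b f e (λ j j<n → h j (m<n⇒m<1+n j<n))) (h n (n<1+n n)))
    (≤-reflexive (sym (^-distribˡ-+-* b (sumᴺ n e) (e n))))

  -- j mod m computed by a cyclic counter; the counter never wraps for m = 0.
  tick : ℕ → ℕ → ℕ
  tick m c = if suc c ≡ᵇ m then 0 else suc c

  residue : ℕ → ℕ → ℕ
  residue m zero = 0
  residue m (suc j) = tick m (residue m j)

  residue-< : ∀ m j → 1 ≤ m → residue m j < m
  residue-< m zero 1≤m = 1≤m
  residue-< m (suc j) 1≤m with suc (residue m j) ≡ᵇ m in eq
  ... | true = 1≤m
  ... | false = ≤∧≢⇒< (residue-< m j 1≤m) (λ e → subst T eq (≡⇒≡ᵇ (suc (residue m j)) m e))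

  residue-quotient : ∀ m j → ∃[ q ] j ≡ q * m + residue m j
  residue-quotient m zero = 0 , refl
  residue-quotient m (suc j) with residue-quotient m j | suc (residue m j) ≡ᵇ m in eq
  ... | q , e | false = q , trans (cong suc e) (sym (+-suc (q * m) (residue m j)))
  ... | q , e | true = suc q , (begin
    suc j                          ≡⟨ cong suc e ⟩
    suc (q * m + residue m j)      ≡⟨ +-suc (q * m) _ ⟨
    q * m + suc (residue m j)      ≡⟨ cong (q * m +_) (≡ᵇ⇒≡ _ m (subst T (sym eq) _)) ⟩
    q * m + m                      ≡⟨ +-comm (q * m) m ⟩
    m + q * m                      ≡⟨ +-identityʳ _ ⟨
    m + q * m + 0                  ∎)
    where open ≡-Reasoning

  residue-≡⇒∣ : ∀ m i j → residue m i ≡ residue m j → m ∣ ∣ i - j ∣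
  residue-≡⇒∣ m i j h with residue-quotient m i | residue-quotient m j
  ... | p , e | q , f = divides ∣ p - q ∣ (begin
    ∣ i - j ∣                                        ≡⟨ cong₂ ∣_-_∣ e f ⟩
    ∣ p * m + residue m i - q * m + residue m j ∣    ≡⟨ cong (λ z → ∣ p * m + z - q * m + residue m j ∣) h ⟩
    ∣ p * m + residue m j - q * m + residue m j ∣
      ≡⟨ cong₂ ∣_-_∣ (+-comm (p * m) _) (+-comm (q * m) _) ⟩
    ∣ residue m j + p * m - residue m j + q * m ∣    ≡⟨ ∣m+n-m+o∣≡∣n-o∣ (residue m j) (p * m) (q * m) ⟩
    ∣ p * m - q * m ∣                                ≡⟨ *-distribʳ-∣-∣ m p q ⟨
    ∣ p - q ∣ * m                                    ∎)
    where open ≡-Reasoning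

  -- If every m < M failed to isolate j₀, then each such m would divide the product
  -- of the distances from j₀ to the other marked points, a number below 2 ^ (1 + s L).
  isolation : ∀ n L s (e : ℕ → ℕ) j₀ → n ≤ 2 ^ L → j₀ < n → sumᴺ n e ≤ s →
    ¬ (∀ m → 1 ≤ m → m < 2 + (suc (s * L) + suc (s * L)) →
       ¬ (∀ j → j < n → residue m j ≡ residue m j₀ → j ≡ j₀ ⊎ e j ≡ 0))
  isolation n L s e j₀ n≤2^L j₀<n ∑e≤s H =
    -- The contradiction is 2 ^ (s L + 1) ≤ N ≤ 2 ^ (s L), with the range of moduli chosen to put
    -- the lower exponent just above the upper one.
    <⇒≱ (^-monoʳ-< 2 (s≤s (s≤s z≤n)) (n<1+n (s * L))) (≤-trans lower upper)
    where
    -- Unmarked points and j₀ itself contribute a factor 1, which keeps the product positive. The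
    -- second argument is the mark `e j`; it reappears as exponent in `dist-≤`, so that the sum of
    -- the marks bounds the product.
    dist : ℕ → ℕ → ℕ
    dist j zero = 1
    dist j (suc _) with j ≟ j₀
    ... | yes _ = 1
    ... | no _ = ∣ j - j₀ ∣
    w : ℕ → ℕ
    w j = dist j (e j)
    N : ℕ
    N = prodᴺ n w
    dist-≥1 : ∀ j d → 1 ≤ dist j d
    dist-≥1 j zero = ≤-refl
    dist-≥1 j (suc d) with j ≟ j₀
    ... | yes _ = ≤-refl
    ... | no j≢j₀ = n≢0⇒n>0 (λ eq → j≢j₀ (∣m-n∣≡0⇒m≡n eq))
    1≤2^L : 1 ≤ 2 ^ L
    1≤2^L = m^n>0 2 L
    dist-≤ : ∀ j d → j < n → dist j d ≤ (2 ^ L) ^ d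
    dist-≤ j zero _ = ≤-refl
    dist-≤ j (suc d) j<n = ≤-trans (bound j<n)
      (m≤m*n (2 ^ L) ((2 ^ L) ^ d) {{m^n≢0 (2 ^ L) d {{>-nonZero 1≤2^L}}}})
      where
      bound : j < n → dist j (suc d) ≤ 2 ^ L
      bound j<n with j ≟ j₀
      ... | yes _ = 1≤2^L
      ... | no _ = ≤-trans (∣m-n∣≤m⊔n j j₀) (≤-trans (⊔-lub (<⇒≤ j<n) (<⇒≤ j₀<n)) n≤2^L)
    -- A marked j ≠ j₀ in the residue class of j₀ would make |j - j₀|, a multiple of m, one of the
    -- factors of N.
    isolates : ∀ m → ¬ m ∣ N → ∀ j → j < n → residue m j ≡ residue m j₀ → j ≡ j₀ ⊎ e j ≡ 0
    isolates m ¬m∣N j j<n r = go (e j) refl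
      where
      go : ∀ d → e j ≡ d → j ≡ j₀ ⊎ e j ≡ 0
      go zero eq = inj₂ eq
      go (suc d) eq with j ≟ j₀ in q
      ... | yes j≡j₀ = inj₁ j≡j₀
      ... | no _ = ⊥-elim (¬m∣N (∣-trans (subst (m ∣_) (sym wj) (residue-≡⇒∣ m j j₀ r)) (factor-∣-prodᴺ n w j<n)))
        where
        wj : w j ≡ ∣ j - j₀ ∣
        wj rewrite eq | q = refl
    multiple : ∀ m → 1 ≤ m → m < 2 + (suc (s * L) + suc (s * L)) → m ∣ N
    multiple m 1≤m m<M with m ∣? N
    ... | yes m∣N = m∣N
    ... | no ¬m∣N = ⊥-elim (H m 1≤m m<M (isolates m ¬m∣N))
    lower : 2 ^ suc (s * L) ≤ N
    lower = common-multiple-≥2^ (suc (s * L)) (prodᴺ-≥1 n w (λ j → dist-≥1 j (e j))) multiple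
    upper : N ≤ 2 ^ (s * L)
    upper = begin
      N                        ≤⟨ prodᴺ-≤-^ n (2 ^ L) w e (λ j → dist-≤ j (e j)) ⟩
      (2 ^ L) ^ sumᴺ n e       ≤⟨ ^-monoʳ-≤ (2 ^ L) {{>-nonZero 1≤2^L}} ∑e≤s ⟩
      (2 ^ L) ^ s              ≡⟨ ^-*-assoc 2 L s ⟩
      2 ^ (L * s)              ≡⟨ cong (2 ^_) (*-comm L s) ⟩
      2 ^ (s * L)              ∎
      where open ≤-Reasoning

  -- Double counting: (s + 1) Σ f ≤ Σ ρ ≤ k < (s + 1)², then s + 1 is cancelled. In the application
  -- f marks the rows still wrong in a fixed column and ρ counts the original errors of each row.
  few-heavy : ∀ n s k (f ρ : ℕ → ℕ) → (∀ i → i < n → suc s * f i ≤ ρ i) →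
    sumᴺ n ρ ≤ k → k < suc s * suc s → sumᴺ n f ≤ s
  few-heavy n s k f ρ h ∑ρ≤k k< = s≤s⁻¹ (*-cancelˡ-< (suc s) (sumᴺ n f) (suc s)
    (≤-<-trans (≤-trans (≤-reflexive (sym (sumᴺ-*ˡ n (suc s) f))) (≤-trans (sumᴺ-mono n h) ∑ρ≤k)) k<))

open Arithmetic

-- The orientation switch: `sel o x y` and `sel o y x` together form the pair (x, y), swapped when
-- `o` is `false`. Applied to indices it transposes a matrix, applied to factors it reverses a
-- product.
sel : ∀ {a} {X : Set a} → Bool → X → X → X
sel true x y = x
sel false x y = y

-- Lists of the positions where an indicator is nonzero.

pick : ∀ {a} {X : Set a} → ℕ → X → List X
pick zero x = []
pick (suc _) x = [ x ]

-- Grows at its end, as the list written by the reporting loop does, so that each iteration matches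
-- one unfolding.
rowList : (ℕ → ℕ → ℕ) → ℕ → ℕ → List (ℕ × ℕ)
rowList d i zero = []
rowList d i (suc j) = rowList d i j ++ pick (d i j) (i , j)

matList : (ℕ → ℕ → ℕ) → ℕ → ℕ → List (ℕ × ℕ)
matList d n zero = []
matList d n (suc i) = matList d n i ++ rowList d i n

length-rowList : ∀ d i n → (∀ j → d i j ≤ 1) → sumᴺ n (d i) ≤ length (rowList d i n)
length-rowList d i zero h = z≤n
length-rowList d i (suc n) h = ≤-trans
  (+-mono-≤ (length-rowList d i n h) (pick-length (d i n) (h n)))
  (≤-reflexive (≡.sym (length-++ (rowList d i n))))
  where
  pick-length : ∀ e → e ≤ 1 → e ≤ length (pick e (i , n))
  pick-length zero _ = z≤n
  pick-length (suc e) h = h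

length-matList : ∀ d n m → (∀ i j → d i j ≤ 1) → sumᴺ m (λ i → sumᴺ n (d i)) ≤ length (matList d n m)
length-matList d n zero h = z≤n
length-matList d n (suc m) h = ≤-trans
  (+-mono-≤ (length-matList d n m h) (length-rowList d m n (h m)))
  (≤-reflexive (≡.sym (length-++ (matList d n m))))

map-filter : ∀ {a b p q} {X : Set a} {Y : Set b} {P : Pred X p} {Q : Pred Y q}
  (P? : Decidable₁ P) (Q? : Decidable₁ Q) (g : X → Y) →
  (∀ x → does (P? x) ≡ does (Q? (g x))) → ∀ xs → map g (filter P? xs) ≡ filter Q? (map g xs)
map-filter P? Q? g h [] = ≡.refl
map-filter P? Q? g h (x ∷ xs) with does (P? x) | does (Q? (g x)) | h x
... | true  | true  | _ = cong (g x ∷_) (map-filter P? Q? g h xs)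
... | false | false | _ = map-filter P? Q? g h xs

map-cartesianProduct : ∀ {a b} {X : Set a} {Y : Set b} (g : X → Y) (xs ys : List X) →
  map (λ (x , y) → g x , g y) (cartesianProduct xs ys) ≡ cartesianProduct (map g xs) (map g ys)
map-cartesianProduct g [] ys = ≡.refl
map-cartesianProduct g (x ∷ xs) ys = ≡.trans (map-++ _ (map (x ,_) ys) (cartesianProduct xs ys))
  (cong₂ _++_ (≡.trans (≡.sym (map-∘ ys)) (map-∘ ys)) (map-cartesianProduct g xs ys))

tabulate-toℕ : ∀ {a} {X : Set a} n (f : ℕ → X) → tabulate {n = n} (f ∘ toℕ) ≡ applyUpTo f n
tabulate-toℕ zero f = ≡.refl
tabulate-toℕ (suc n) f = cong (f 0 ∷_) (tabulate-toℕ n (f ∘ suc))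

map-toℕ-allFin : ∀ n → map toℕ (allFin n) ≡ upTo n
map-toℕ-allFin n = ≡.trans (map-tabulate id toℕ) (tabulate-toℕ n id)

module _ (d : ℕ → ℕ → ℕ) where

  nonzero? : ((i , j) : ℕ × ℕ) → Dec (d i j ≢ 0)
  nonzero? (i , j) = ¬? (d i j ℕ.≟ 0)

  filter-singleton : ∀ i j → filter nonzero? [ i , j ] ≡ pick (d i j) (i , j)
  filter-singleton i j with d i j
  ... | zero = ≡.refl
  ... | suc _ = ≡.refl

  filter-row : ∀ i n → filter nonzero? (map (i ,_) (upTo n)) ≡ rowList d i n
  filter-row i zero = ≡.refl
  filter-row i (suc n) = begin
    filter nonzero? (map (i ,_) (upTo (suc n)))
      ≡⟨ cong (filter nonzero? ∘ map (i ,_)) (upTo-∷ʳ n) ⟨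
    filter nonzero? (map (i ,_) (upTo n ++ [ n ]))
      ≡⟨ cong (filter nonzero?) (map-++ (i ,_) (upTo n) [ n ]) ⟩
    filter nonzero? (map (i ,_) (upTo n) ++ [ i , n ])
      ≡⟨ filter-++ nonzero? (map (i ,_) (upTo n)) [ i , n ] ⟩
    filter nonzero? (map (i ,_) (upTo n)) ++ filter nonzero? [ i , n ]
      ≡⟨ cong₂ _++_ (filter-row i n) (filter-singleton i n) ⟩
    rowList d i (suc n) ∎
    where open ≡.≡-Reasoning

  filter-matrix : ∀ n m → filter nonzero? (cartesianProduct (upTo m) (upTo n)) ≡ matList d n m
  filter-matrix n zero = ≡.refl
  filter-matrix n (suc m) = begin
    filter nonzero? (cartesianProduct (upTo (suc m)) (upTo n))
      ≡⟨ cong (λ l → filter nonzero? (cartesianProduct l (upTo n))) (upTo-∷ʳ m) ⟨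
    filter nonzero? (cartesianProduct (upTo m ++ [ m ]) (upTo n))
      ≡⟨ cong (filter nonzero?) (cartesianProductWith-distribʳ-++ _,_ (upTo m) [ m ] (upTo n)) ⟩
    filter nonzero? (cartesianProduct (upTo m) (upTo n) ++ (map (m ,_) (upTo n) ++ []))
      ≡⟨ filter-++ nonzero? (cartesianProduct (upTo m) (upTo n)) _ ⟩
    filter nonzero? (cartesianProduct (upTo m) (upTo n)) ++ filter nonzero? (map (m ,_) (upTo n) ++ [])
      ≡⟨ cong₂ _++_ (filter-matrix n m)
           (≡.trans (cong (filter nonzero?) (++-identityʳ (map (m ,_) (upTo n)))) (filter-row m n)) ⟩
    matList d n (suc m) ∎
    where open ≡.≡-Reasoning

-- Sums in the ring, test vectors, and the correctness of light rows.

module Algebraic {r ℓ} (R : Ring r ℓ) (_≟_ : Decidable (Ring._≈_ R)) where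

  open Ring R renaming (_+_ to _+ᴿ_; _*_ to _*ᴿ_; -_ to -ᴿ_)
  open SemiringSum semiring using (sum; sum-init-last)
  open OverRing R _≟_ using (Matrix; _⊗_; differences; entry)
  open GroupProperties +-group using () renaming (∙-cancelˡ to +-cancelˡᴿ; ∙-cancelʳ to +-cancelʳᴿ)
  open import Relation.Binary.Reasoning.Setoid setoid

  -- Adds the last term on the right, like the accumulator in `dot`; `sumᴿ-sum` identifies it with
  -- the sum over `Fin n` in the definition of the matrix product.
  sumᴿ : ℕ → (ℕ → Carrier) → Carrier
  sumᴿ zero f = 0#
  sumᴿ (suc n) f = sumᴿ n f +ᴿ f n

  sumᴿ-cong : ∀ n {f g} → (∀ i → i < n → f i ≈ g i) → sumᴿ n f ≈ sumᴿ n g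
  sumᴿ-cong zero h = refl
  sumᴿ-cong (suc n) h = +-cong (sumᴿ-cong n (λ i i<n → h i (m<n⇒m<1+n i<n))) (h n (n<1+n n))

  sumᴿ-+ : ∀ n f g → sumᴿ n (λ i → f i +ᴿ g i) ≈ sumᴿ n f +ᴿ sumᴿ n g
  sumᴿ-+ zero f g = sym (+-identityˡ 0#)
  sumᴿ-+ (suc n) f g = begin
    sumᴿ n (λ i → f i +ᴿ g i) +ᴿ (f n +ᴿ g n)   ≈⟨ +-congʳ (sumᴿ-+ n f g) ⟩
    (sumᴿ n f +ᴿ sumᴿ n g) +ᴿ (f n +ᴿ g n)      ≈⟨ +-assoc _ _ _ ⟩
    sumᴿ n f +ᴿ (sumᴿ n g +ᴿ (f n +ᴿ g n))      ≈⟨ +-congˡ (+-assoc _ _ _) ⟨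
    sumᴿ n f +ᴿ (sumᴿ n g +ᴿ f n +ᴿ g n)        ≈⟨ +-congˡ (+-congʳ (+-comm _ _)) ⟩
    sumᴿ n f +ᴿ (f n +ᴿ sumᴿ n g +ᴿ g n)        ≈⟨ +-congˡ (+-assoc _ _ _) ⟩
    sumᴿ n f +ᴿ (f n +ᴿ (sumᴿ n g +ᴿ g n))      ≈⟨ +-assoc _ _ _ ⟨
    sumᴿ n f +ᴿ f n +ᴿ (sumᴿ n g +ᴿ g n)        ∎

  sumᴿ-0 : ∀ n → sumᴿ n (λ _ → 0#) ≈ 0#
  sumᴿ-0 zero = refl
  sumᴿ-0 (suc n) = trans (+-congʳ (sumᴿ-0 n)) (+-identityˡ 0#)

  sumᴿ-comm : ∀ m n (f : ℕ → ℕ → Carrier) →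
    sumᴿ m (λ i → sumᴿ n (λ j → f i j)) ≈ sumᴿ n (λ j → sumᴿ m (λ i → f i j))
  sumᴿ-comm zero n f = sym (sumᴿ-0 n)
  sumᴿ-comm (suc m) n f = trans (+-congʳ (sumᴿ-comm m n f))
    (sym (sumᴿ-+ n (λ j → sumᴿ m (λ i → f i j)) (f m)))

  -- Cancellation in the additive group: the last term goes as long as j₀ lies before it, and once
  -- j₀ is last, the whole initial sum goes.
  sumᴿ-cancel : ∀ n {f g} j₀ → j₀ < n → (∀ j → j < n → j ≢ j₀ → f j ≈ g j) →
    sumᴿ n f ≈ sumᴿ n g → f j₀ ≈ g j₀
  sumᴿ-cancel (suc n) {f} {g} j₀ j₀<1+n h eq with m≤n⇒m<n∨m≡n (s≤s⁻¹ j₀<1+n)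
  ... | inj₁ j₀<n = sumᴿ-cancel n j₀ j₀<n (λ j j<n → h j (m<n⇒m<1+n j<n))
        (+-cancelʳᴿ (g n) _ _ (trans (+-congˡ (sym (h n (n<1+n n) (≡.≢-sym (<⇒≢ j₀<n))))) eq))
  ... | inj₂ ≡.refl = +-cancelˡᴿ (sumᴿ n g) _ _
        (trans (+-congʳ (sym (sumᴿ-cong n (λ j j<n → h j (m<n⇒m<1+n j<n) (<⇒≢ j<n))))) eq)

  sumᴿ-sum : ∀ n (f : ℕ → Carrier) (t : Fin n → Carrier) → (∀ i → f (toℕ i) ≈ t i) → sumᴿ n f ≈ sum t
  sumᴿ-sum zero f t h = refl
  sumᴿ-sum (suc n) f t h = trans
    (+-cong (sumᴿ-sum n f _ (λ i → trans (reflexive (cong f (≡.sym (toℕ-inject₁ i)))) (h _)))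
            (trans (reflexive (cong f (≡.sym (toℕ-fromℕ n)))) (h _)))
    (sym (sum-init-last t))

  mismatch : Carrier → Carrier → ℕ
  mismatch x y = if does (x ≟ y) then 0 else 1

  mismatch-≤1 : ∀ x y → mismatch x y ≤ 1
  mismatch-≤1 x y with does (x ≟ y)
  ... | true = z≤n
  ... | false = ≤-refl

  mismatch≡0⇒≈ : ∀ {x y} → mismatch x y ≡ 0 → x ≈ y
  mismatch≡0⇒≈ {x} {y} h with x ≟ y
  ... | yes x≈y = x≈y
  mismatch≡0⇒≈ () | no _

  ≈⇒mismatch≡0 : ∀ {x y} → x ≈ y → mismatch x y ≡ 0
  ≈⇒mismatch≡0 {x} {y} h with x ≟ y
  ... | yes _ = ≡.refl
  ... | no x≉y = ⊥-elim (x≉y h)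

  mismatch-cong : ∀ {x y x′ y′} → x ≈ x′ → y ≈ y′ → mismatch x y ≡ mismatch x′ y′
  mismatch-cong {x} {y} {x′} {y′} p q with x ≟ y | x′ ≟ y′
  ... | yes _ | yes _ = ≡.refl
  ... | no _ | no _ = ≡.refl
  ... | yes h | no ¬h = ⊥-elim (¬h (trans (sym p) (trans h q)))
  ... | no ¬h | yes h = ⊥-elim (¬h (trans p (trans h (sym q))))

  χ : ℕ → ℕ → ℕ → Carrier
  χ m r j = if residue m j ≡ᵇ r then 1# else 0#

  χ-self : ∀ m j → χ m (residue m j) j ≡ 1#
  χ-self m j with residue m j ≡ᵇ residue m j | ≡⇒≡ᵇ (residue m j) (residue m j) ≡.refl
  ... | true | _ = ≡.refl

  χ-other : ∀ m r j → residue m j ≢ r → χ m r j ≡ 0#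
  χ-other m r j h with residue m j ≡ᵇ r in eq
  ... | true = ⊥-elim (h (≡ᵇ⇒≡ _ r (subst T (≡.sym eq) _)))
  ... | false = ≡.refl

  -- o = false is multiplication in the opposite ring.
  mul : Bool → Carrier → Carrier → Carrier
  mul o x y = sel o x y *ᴿ sel o y x

  mul-cong : ∀ o {x x′ y y′} → x ≈ x′ → y ≈ y′ → mul o x y ≈ mul o x′ y′
  mul-cong true  p q = *-cong p q
  mul-cong false p q = *-cong q p

  mul-assoc : ∀ o x y z → mul o (mul o x y) z ≈ mul o x (mul o y z)
  mul-assoc true  x y z = *-assoc x y z
  mul-assoc false x y z = sym (*-assoc z y x)

  mul-identityʳ : ∀ o x → mul o x 1# ≈ x
  mul-identityʳ true  = *-identityʳ
  mul-identityʳ false = *-identityˡ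

  mul-zeroˡ : ∀ o x → mul o 0# x ≈ 0#
  mul-zeroˡ true  = zeroˡ
  mul-zeroˡ false = zeroʳ

  mul-zeroʳ : ∀ o x → mul o x 0# ≈ 0#
  mul-zeroʳ true  = zeroʳ
  mul-zeroʳ false = zeroˡ

  mul-distribˡ : ∀ o x y z → mul o x (y +ᴿ z) ≈ mul o x y +ᴿ mul o x z
  mul-distribˡ true  = distribˡ
  mul-distribˡ false = distribʳ

  mul-distribʳ : ∀ o x y z → mul o (y +ᴿ z) x ≈ mul o y x +ᴿ mul o z x
  mul-distribʳ true  = distribʳ
  mul-distribʳ false = distribˡ

  module Oriented (o : Bool) where

    infixl 7 _∗_
    _∗_ : Carrier → Carrier → Carrier
    _∗_ = mul o

    ∗-sumᴿ : ∀ n x f → x ∗ sumᴿ n f ≈ sumᴿ n (λ i → x ∗ f i)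
    ∗-sumᴿ zero x f = mul-zeroʳ o x
    ∗-sumᴿ (suc n) x f = trans (mul-distribˡ o x _ _) (+-congʳ (∗-sumᴿ n x f))

    sumᴿ-∗ : ∀ n x f → sumᴿ n f ∗ x ≈ sumᴿ n (λ i → f i ∗ x)
    sumᴿ-∗ zero x f = mul-zeroˡ o x
    sumᴿ-∗ (suc n) x f = trans (mul-distribʳ o x _ _) (+-congʳ (sumᴿ-∗ n x f))

    -- X (Y c) = (X Y) c, by exchanging two finite sums. This is what lets a row of the unknown
    -- product be tested with matrix-vector products only.
    matvec-assoc : ∀ n (x : ℕ → Carrier) (y : ℕ → ℕ → Carrier) (c : ℕ → Carrier) →
      sumᴿ n (λ l → x l ∗ sumᴿ n (λ j → y l j ∗ c j)) ≈ sumᴿ n (λ j → sumᴿ n (λ l → x l ∗ y l j) ∗ c j)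
    matvec-assoc n x y c = begin
      sumᴿ n (λ l → x l ∗ sumᴿ n (λ j → y l j ∗ c j))
        ≈⟨ sumᴿ-cong n (λ l _ → trans (∗-sumᴿ n (x l) _)
             (sumᴿ-cong n (λ j _ → sym (mul-assoc o (x l) (y l j) (c j))))) ⟩
      sumᴿ n (λ l → sumᴿ n (λ j → (x l ∗ y l j) ∗ c j))
        ≈⟨ sumᴿ-comm n n (λ l j → (x l ∗ y l j) ∗ c j) ⟩
      sumᴿ n (λ j → sumᴿ n (λ l → (x l ∗ y l j) ∗ c j))
        ≈⟨ sumᴿ-cong n (λ j _ → sym (sumᴿ-∗ n (c j) (λ l → x l ∗ y l j))) ⟩
      sumᴿ n (λ j → sumᴿ n (λ l → x l ∗ y l j) ∗ c j) ∎

    Passes : ℕ → (ℕ → Carrier) → (ℕ → Carrier) → ℕ → ℕ → Set ℓ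
    Passes n z c m r = sumᴿ n (λ j → z j ∗ χ m r j) ≈ sumᴿ n (λ j → c j ∗ χ m r j)

    -- Suppose z j₀ is wrong and m isolates j₀. In the test with r = j₀ mod m, which is below m and
    -- hence in the tested range, all other terms agree: outside the residue class χ kills them,
    -- inside it the entries are right. Cancelling them leaves z j₀ = c j₀.
    light-row-correct : ∀ n L s z c → n ≤ 2 ^ L →
      (∀ m r → m < 2 + (suc (s * L) + suc (s * L)) → r < 2 + (suc (s * L) + suc (s * L)) → Passes n z c m r) →
      sumᴺ n (λ j → mismatch (z j) (c j)) ≤ s → ∀ j → j < n → z j ≈ c j
    light-row-correct n L s z c n≤2^L passes light j₀ j₀<n with z j₀ ≟ c j₀
    ... | yes p = p
    ... | no z≉c = ⊥-elim (isolation n L s (λ j → mismatch (z j) (c j)) j₀ n≤2^L j₀<n light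
      λ m 1≤m m<M iso → z≉c (begin
        z j₀                               ≈⟨ mul-identityʳ o _ ⟨
        z j₀ ∗ 1#                          ≡⟨ cong (z j₀ ∗_) (χ-self m j₀) ⟨
        z j₀ ∗ χ m (residue m j₀) j₀       ≈⟨ sumᴿ-cancel n j₀ j₀<n (agree m iso)
                                                (passes m _ m<M (<-trans (residue-< m j₀ 1≤m) m<M)) ⟩
        c j₀ ∗ χ m (residue m j₀) j₀       ≡⟨ cong (c j₀ ∗_) (χ-self m j₀) ⟩
        c j₀ ∗ 1#                          ≈⟨ mul-identityʳ o _ ⟩
        c j₀                               ∎))
      where
      agree : ∀ m → (∀ j → j < n → residue m j ≡ residue m j₀ → j ≡ j₀ ⊎ mismatch (z j) (c j) ≡ 0) →
        ∀ j → j < n → j ≢ j₀ → z j ∗ χ m (residue m j₀) j ≈ c j ∗ χ m (residue m j₀) j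
      agree m iso j j<n j≢j₀ with residue m j ℕ.≟ residue m j₀
      ... | no ≢r = trans (mul-cong o refl (reflexive (χ-other m _ j ≢r)))
        (trans (mul-zeroʳ o _) (sym (trans (mul-cong o refl (reflexive (χ-other m _ j ≢r))) (mul-zeroʳ o _))))
      ... | yes ≡r with iso j j<n ≡r
      ...   | inj₁ j≡j₀ = ⊥-elim (j≢j₀ j≡j₀)
      ...   | inj₂ e≡0 = mul-cong o (mismatch≡0⇒≈ e≡0) refl

  entry-toℕ : ∀ {n} (M : Matrix n) i j → entry M (toℕ i) (toℕ j) ≡ M i j
  entry-toℕ {n} M i j with toℕ i <? n | toℕ j <? n
  ... | yes p | yes q = cong₂ M (fromℕ<-toℕ i p) (fromℕ<-toℕ j q)
  ... | no ¬p | _     = ⊥-elim (¬p (toℕ<n i))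
  ... | yes _ | no ¬q = ⊥-elim (¬q (toℕ<n j))

  entry-⊗ : ∀ {n} (A B : Matrix n) i j →
    sumᴿ n (λ l → entry A (toℕ i) l *ᴿ entry B l (toℕ j)) ≈ (A ⊗ B) i j
  entry-⊗ {n} A B i j = sumᴿ-sum n _ (λ l → A i l *ᴿ B l j)
    (λ l → *-cong (reflexive (entry-toℕ A i l)) (reflexive (entry-toℕ B l j)))

  -- Both lists run through the positions row by row, so the permutation demanded of the report is
  -- an equality.
  differences-matList : ∀ {n} (M N : Matrix n) (d : ℕ → ℕ → ℕ) →
    (∀ i j → d (toℕ i) (toℕ j) ≡ mismatch (M i j) (N i j)) →
    map (λ (i , j) → toℕ i , toℕ j) (differences M N) ≡ matList d n n
  differences-matList {n} M N d h = ≡.trans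
    (map-filter _ (nonzero? d) (λ (i , j) → toℕ i , toℕ j) agrees (cartesianProduct (allFin n) (allFin n)))
    (≡.trans (cong (filter (nonzero? d)) (≡.trans (map-cartesianProduct toℕ (allFin n) (allFin n))
                                   (cong₂ cartesianProduct (map-toℕ-allFin n) (map-toℕ-allFin n))))
             (filter-matrix d n n))
    where
    agrees : ((i , j) : Fin n × Fin n) → does (¬? (M i j ≟ N i j)) ≡ does (nonzero? d (toℕ i , toℕ j))
    agrees (i , j) rewrite h i j with does (M i j ≟ N i j)
    ... | true = ≡.refl
    ... | false = ≡.refl

-- Frame conditions and a calculus of time-bounded runs.

assigns writesInt writesRing : Program → ℕ → Bool
assigns skip x = false
assigns (y ≔ _) x = x ≡ᵇ y
assigns (int _ [ _ , _ ]≔ _) x = false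
assigns (ring _ [ _ , _ ]≔ _) x = false
assigns (P ︔ Q) x = assigns P x ∨ assigns Q x
assigns (If _ Then P Else Q) x = assigns P x ∨ assigns Q x
assigns (While _ Do P) x = assigns P x
writesInt skip a = false
writesInt (_ ≔ _) a = false
writesInt (int b [ _ , _ ]≔ _) a = a ≡ᵇ b
writesInt (ring _ [ _ , _ ]≔ _) a = false
writesInt (P ︔ Q) a = writesInt P a ∨ writesInt Q a
writesInt (If _ Then P Else Q) a = writesInt P a ∨ writesInt Q a
writesInt (While _ Do P) a = writesInt P a
writesRing skip a = false
writesRing (_ ≔ _) a = false
writesRing (int _ [ _ , _ ]≔ _) a = false
writesRing (ring b [ _ , _ ]≔ _) a = a ≡ᵇ b
writesRing (P ︔ Q) a = writesRing P a ∨ writesRing Q a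
writesRing (If _ Then P Else Q) a = writesRing P a ∨ writesRing Q a
writesRing (While _ Do P) a = writesRing P a

∨-falseˡ : ∀ x {y} → T (not (x ∨ y)) → T (not x)
∨-falseˡ false _ = _

∨-falseʳ : ∀ x {y} → T (not (x ∨ y)) → T (not y)
∨-falseʳ false h = h

updateVar-other : ∀ vs x v y → T (not (y ≡ᵇ x)) → updateVar vs x v y ≡ vs y
updateVar-other vs x v y h with y ≡ᵇ x
... | false = ≡.refl

updateVar-same : ∀ vs x v → updateVar vs x v x ≡ v
updateVar-same vs x v with x ≡ᵇ x | ≡⇒≡ᵇ x x ≡.refl
... | true | _ = ≡.refl

updateArr-other : ∀ {a} {X : Set a} (m : Arrays X) b i j v c i′ j′ →
  T (not (c ≡ᵇ b)) → updateArr m b i j v c i′ j′ ≡ m c i′ j′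
updateArr-other m b i j v c i′ j′ h with c ≡ᵇ b
... | false = ≡.refl

updateArr-row : ∀ {a} {X : Set a} (m : Arrays X) b i j v c i′ j′ →
  i′ ≢ i → updateArr m b i j v c i′ j′ ≡ m c i′ j′
updateArr-row m b i j v c i′ j′ h with c ≡ᵇ b | i′ ≡ᵇ i in eq
... | false | _     = ≡.refl
... | true  | false = ≡.refl
... | true  | true  = ⊥-elim (h (≡ᵇ⇒≡ i′ i (subst T (≡.sym eq) _)))

updateArr-column : ∀ {a} {X : Set a} (m : Arrays X) b i j v c i′ j′ →
  j′ ≢ j → updateArr m b i j v c i′ j′ ≡ m c i′ j′
updateArr-column m b i j v c i′ j′ h with c ≡ᵇ b | i′ ≡ᵇ i | j′ ≡ᵇ j in eq
... | false | _     | _     = ≡.refl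
... | true  | false | _     = ≡.refl
... | true  | true  | false = ≡.refl
... | true  | true  | true  = ⊥-elim (h (≡ᵇ⇒≡ j′ j (subst T (≡.sym eq) _)))

updateArr-same : ∀ {a} {X : Set a} (m : Arrays X) b i j v → updateArr m b i j v b i j ≡ v
updateArr-same m b i j v
  with b ≡ᵇ b | i ≡ᵇ i | j ≡ᵇ j | ≡⇒≡ᵇ b b ≡.refl | ≡⇒≡ᵇ i i ≡.refl | ≡⇒≡ᵇ j j ≡.refl
... | true | true | true | _ | _ | _ = ≡.refl

For : ℕ → ℕ → Program → Program
For x b P = x ≔ lit 0 ︔ While (var x <' var b) Do (P ︔ x ≔ var x ⊕ lit 1)

module Machine {r ℓ} (R : Ring r ℓ) (_≟_ : Decidable (Ring._≈_ R)) where

  open OverRing R _≟_ public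

  -- The side conditions are Boolean and syntactic: for a concrete program and name, `T (not …)`
  -- computes to the unit type and the implicit argument fills itself in. Arrays are tracked by
  -- name, not by cell.
  record Frame (P : Program) (s s′ : State) : Set r where
    field
      var=  : ∀ x → {T (not (assigns P x))} → vars s′ x ≡ vars s x
      int=  : ∀ a i j → {T (not (writesInt P a))} → ints s′ a i j ≡ ints s a i j
      ring= : ∀ a i j → {T (not (writesRing P a))} → rings s′ a i j ≡ rings s a i j
  open Frame public

  frame-seq : ∀ {P Q s s′ s″} → Frame P s s′ → Frame Q s′ s″ → Frame (P ︔ Q) s s″
  frame-seq {P} F G = record
    { var=  = λ x {h} → ≡.trans (var= G x {∨-falseʳ (assigns P x) h}) (var= F x {∨-falseˡ (assigns P x) h})
    ; int=  = λ a i j {h} → ≡.trans (int= G a i j {∨-falseʳ (writesInt P a) h}) (int= F a i j {∨-falseˡ (writesInt P a) h})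
    ; ring= = λ a i j {h} → ≡.trans (ring= G a i j {∨-falseʳ (writesRing P a) h}) (ring= F a i j {∨-falseˡ (writesRing P a) h})
    }

  frame-refl : ∀ {P s} → Frame P s s
  frame-refl = record { var= = λ _ → ≡.refl ; int= = λ _ _ _ → ≡.refl ; ring= = λ _ _ _ → ≡.refl }

  frame-while : ∀ {b P s s′} → Frame P s s′ → Frame (While b Do P) s s′
  frame-while F = record
    { var=  = λ x {h} → var= F x {h}
    ; int=  = λ a i j {h} → int= F a i j {h}
    ; ring= = λ a i j {h} → ring= F a i j {h}
    }

  frame-trans : ∀ {P s s′ s″} → Frame P s s′ → Frame P s′ s″ → Frame P s s″
  frame-trans F G = record
    { var=  = λ x {h} → ≡.trans (var= G x {h}) (var= F x {h})
    ; int=  = λ a i j {h} → ≡.trans (int= G a i j {h}) (int= F a i j {h})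
    ; ring= = λ a i j {h} → ≡.trans (ring= G a i j {h}) (ring= F a i j {h})
    }

  ⇓-frame : ∀ {P s t s′} → P ⊢ s ⇓[ t ] s′ → Frame P s s′
  ⇓-frame ⇓skip = frame-refl
  ⇓-frame (⇓var {s} {x} {e}) = record
    { var= = λ y {h} → updateVar-other (vars s) x (⟦ e ⟧ᴵ s) y h
    ; int= = λ _ _ _ → ≡.refl ; ring= = λ _ _ _ → ≡.refl }
  ⇓-frame (⇓int {s} {a} {e} {f} {g}) = record
    { var= = λ _ → ≡.refl
    ; int= = λ b i j {h} → updateArr-other (ints s) a (⟦ e ⟧ᴵ s) (⟦ f ⟧ᴵ s) (⟦ g ⟧ᴵ s) b i j h
    ; ring= = λ _ _ _ → ≡.refl }
  ⇓-frame (⇓ring {s} {a} {e} {f} {x}) = record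
    { var= = λ _ → ≡.refl
    ; int= = λ _ _ _ → ≡.refl
    ; ring= = λ b i j {h} → updateArr-other (rings s) a (⟦ e ⟧ᴵ s) (⟦ f ⟧ᴵ s) (⟦ x ⟧ᴿ s) b i j h }
  ⇓-frame (⇓seq p q) = frame-seq (⇓-frame p) (⇓-frame q)
  ⇓-frame (⇓then {b} {P} {Q} _ p) = let F = ⇓-frame p in record
    { var= = λ x {h} → var= F x {∨-falseˡ (assigns P x) h}
    ; int= = λ a i j {h} → int= F a i j {∨-falseˡ (writesInt P a) h}
    ; ring= = λ a i j {h} → ring= F a i j {∨-falseˡ (writesRing P a) h} }
  ⇓-frame (⇓else {b} {P} {Q} _ p) = let F = ⇓-frame p in record
    { var= = λ x {h} → var= F x {∨-falseʳ (assigns P x) h}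
    ; int= = λ a i j {h} → int= F a i j {∨-falseʳ (writesInt P a) h}
    ; ring= = λ a i j {h} → ring= F a i j {∨-falseʳ (writesRing P a) h} }
  ⇓-frame (⇓stop _) = frame-refl
  ⇓-frame (⇓loop _ p q) = frame-trans (frame-while (⇓-frame p)) (⇓-frame q)

  setVar : ℕ → ℕ → State → State
  setVar x v s = state (updateVar (vars s) x v) (ints s) (rings s)

  -- The time bound is kept as a product c * p of a numeral and a growth rate.
  record Run {q} (P : Program) (s : State) (c p : ℕ) (Q : State → Set q) : Set (r ⊔ˡ q) where
    constructor ran
    field
      {time}  : ℕ
      {final} : State
      steps   : P ⊢ s ⇓[ time ] final
      bound   : time ≤ c * p
      post    : Q final

  c≤c*p : ∀ {c p} → 1 ≤ p → c ≤ c * p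
  c≤c*p {c} {p} 1≤p = ℕ.m≤m*n c p {{>-nonZero 1≤p}}

  run-skip : ∀ {q} {s p} {Q : State → Set q} → Q s → Run skip s 0 p Q
  run-skip = ran ⇓skip z≤n

  run-var : ∀ {q} {s x e p} {Q : State → Set q} → 1 ≤ p →
    Q (setVar x (⟦ e ⟧ᴵ s) s) → Run (x ≔ e) s (1 + costᴵ e) p Q
  run-var 1≤p = ran ⇓var (c≤c*p 1≤p)

  run-int : ∀ {q} {s a e f g p} {Q : State → Set q} → 1 ≤ p →
    Q (state (vars s) (updateArr (ints s) a (⟦ e ⟧ᴵ s) (⟦ f ⟧ᴵ s) (⟦ g ⟧ᴵ s)) (rings s)) →
    Run (int a [ e , f ]≔ g) s (1 + costᴵ e + costᴵ f + costᴵ g) p Q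
  run-int 1≤p = ran ⇓int (c≤c*p 1≤p)

  run-ring : ∀ {q} {s a e f x p} {Q : State → Set q} → 1 ≤ p →
    Q (state (vars s) (ints s) (updateArr (rings s) a (⟦ e ⟧ᴵ s) (⟦ f ⟧ᴵ s) (⟦ x ⟧ᴿ s))) →
    Run (ring a [ e , f ]≔ x) s (1 + costᴵ e + costᴵ f + costᴿ x) p Q
  run-ring 1≤p = ran ⇓ring (c≤c*p 1≤p)

  -- The continuation receives the frame of the first run beside its postcondition, so facts about
  -- untouched storage stay out of the postconditions.
  run-seq : ∀ {q q′} {P P′ s c c′ p} {Q : State → Set q} {Q′ : State → Set q′} →
    Run P s c p Q → (∀ s′ → Frame P s s′ → Q s′ → Run P′ s′ c′ p Q′) →
    Run (P ︔ P′) s (c + c′) p Q′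
  run-seq {c = c} {c′} {p} (ran d t≤ h) k with k _ (⇓-frame d) h
  ... | ran d′ t′≤ h′ = ran (⇓seq d d′)
    (≤-trans (+-mono-≤ t≤ t′≤) (≤-reflexive (≡.sym (ℕ.*-distribʳ-+ p c c′)))) h′

  run-if : ∀ {q} {b P P′ s c p} {Q : State → Set q} → 1 ≤ p →
    (⟦ b ⟧ᵀ s ≡ true → Run P s c p Q) → (⟦ b ⟧ᵀ s ≡ false → Run P′ s c p Q) →
    Run (If b Then P Else P′) s (costᵀ b + c) p Q
  run-if {b = b} {s = s} {c} {p} 1≤p k k′ with ⟦ b ⟧ᵀ s in eq
  ... | true with k ≡.refl
  ...   | ran d t≤ h = ran (⇓then eq d)
    (≤-trans (+-mono-≤ (c≤c*p 1≤p) t≤) (≤-reflexive (≡.sym (ℕ.*-distribʳ-+ p (costᵀ b) c)))) h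
  run-if {b = b} {s = s} {c} {p} 1≤p k k′ | false with k′ ≡.refl
  ...   | ran d t≤ h = ran (⇓else eq d)
    (≤-trans (+-mono-≤ (c≤c*p 1≤p) t≤) (≤-reflexive (≡.sym (ℕ.*-distribʳ-+ p (costᵀ b) c)))) h

  run-const : ∀ {q} {P s c p} {Q : State → Set q} c′ → c ≤ c′ → Run P s c p Q → Run P s c′ p Q
  run-const {p = p} c′ c≤c′ (ran d t≤ h) = ran d (≤-trans t≤ (*-monoˡ-≤ p c≤c′)) h

  run-grow : ∀ {q} {P s c p} {Q : State → Set q} p′ → p ≤ p′ → Run P s c p Q → Run P s c p′ Q
  run-grow {c = c} p′ p≤p′ (ran d t≤ h) = ran d (≤-trans t≤ (*-monoʳ-≤ c p≤p′)) h

  run-post : ∀ {q q′} {P s c p} {Q : State → Set q} {Q′ : State → Set q′} →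
    (∀ s′ → Frame P s s′ → Q s′ → Q′ s′) → Run P s c p Q → Run P s c p Q′
  run-post k (ran d t≤ h) = ran d t≤ (k _ (⇓-frame d) h)

  -- The body must establish the next invariant for every value `v` of the counter, which makes it
  -- insensitive to the increment that follows. The rate `p` may vary with the iteration, for loops
  -- in which only a few rounds are expensive. The 12 consists of 7 per round (3 for the test, 4 for
  -- the increment) and 5 for initialisation and final test; all of it is absorbed because 1 ≤ N ≤ Σ
  -- p.
  run-for-sum : ∀ {q} {x b P s c} (p : ℕ → ℕ) (I : ℕ → State → Set q)
    {_ : T (not (assigns P x))} {_ : T (not (assigns P b))} {_ : T (not (b ≡ᵇ x))} →
    1 ≤ vars s b → (∀ i → 1 ≤ p i) →
    I 0 (setVar x 0 s) →
    (∀ i s′ → i < vars s b → Frame (For x b P) s s′ → vars s′ x ≡ i → I i s′ →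
      Run P s′ c (p i) (λ s″ → ∀ v → I (suc i) (setVar x v s″))) →
    Run (For x b P) s (c + 12) (sumᴺ (vars s b) p) (I (vars s b))
  run-for-sum {q} {x} {b} {P} {s} {c} p I {px} {pb} {b≢x} 1≤N 1≤p I₀ step =
    ran (⇓seq ⇓var (Loop.steps′ whole)) total (Loop.post′ whole)
    where
    N = vars s b
    g : ℕ → ℕ
    g i = c * p i + 7
    B = P ︔ x ≔ var x ⊕ lit 1
    record Loop (i : ℕ) (s′ : State) : Set (r ⊔ˡ q) where
      field
        {time′}  : ℕ
        {final′} : State
        steps′   : While (var x <' var b) Do B ⊢ s′ ⇓[ time′ ] final′
        -- The budget of the rounds already done stands on the left, so that initial sums suffice;
        -- the 3 is the final failing test.
        bound′   : time′ + sumᴺ i g ≤ 3 + sumᴺ N g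
        post′    : I N final′
    s₀ = setVar x 0 s
    F₀ : Frame (For x b P) s s₀
    F₀ = frame-seq {P = x ≔ lit 0} (⇓-frame (⇓var {s} {x} {lit 0})) frame-refl
    swap₁ : ∀ t u v → 3 + (t + 4) + u + v ≡ u + (v + (t + 7))
    swap₁ = solve-∀
    loop : ∀ d i s′ → i + d ≡ N → Frame (For x b P) s s′ → vars s′ x ≡ i → vars s′ b ≡ N → I i s′ → Loop i s′
    loop zero i s′ eq F x= b= h with ≡.trans (≡.sym (ℕ.+-identityʳ i)) eq
    ... | ≡.refl = record { steps′ = ⇓stop test ; bound′ = ≤-refl ; post′ = h }
      where
      test : (vars s′ x <ᵇ vars s′ b) ≡ false
      test rewrite x= | b= with N <ᵇ N in e
      ... | false = ≡.refl
      ... | true = ⊥-elim (ℕ.<-irrefl ≡.refl (ℕ.<ᵇ⇒< N N (subst T (≡.sym e) _)))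
    loop (suc d) i s′ eq F x= b= h with step i s′ i<N F x= h
      where
      i<N : i < N
      i<N = subst (i <_) eq (ℕ.m<m+n i (s≤s z≤n))
    ... | ran {t₁} {s₁} d₁ t₁≤ h₁ = record
      { steps′ = ⇓loop test (⇓seq d₁ ⇓var) (Loop.steps′ rest)
      ; bound′ = ≤-trans (≤-reflexive (swap₁ t₁ (Loop.time′ rest) (sumᴺ i g)))
          (≤-trans (+-monoʳ-≤ (Loop.time′ rest) (+-monoʳ-≤ (sumᴺ i g) (+-monoˡ-≤ 7 t₁≤))) (Loop.bound′ rest))
      ; post′ = Loop.post′ rest }
      where
      i<N : i < N
      i<N = subst (i <_) eq (ℕ.m<m+n i (s≤s z≤n))
      test : (vars s′ x <ᵇ vars s′ b) ≡ true
      test rewrite x= | b= with i <ᵇ N in e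
      ... | true = ≡.refl
      ... | false = ⊥-elim (subst T e (ℕ.<⇒<ᵇ i<N))
      s₂ = setVar x (vars s₁ x + 1) s₁
      F₁ : Frame P s′ s₁
      F₁ = ⇓-frame d₁
      F₂ : Frame (For x b P) s′ s₂
      F₂ = frame-seq {P = x ≔ lit 0} {Q = While (var x <' var b) Do B} frame-refl (frame-while (⇓-frame (⇓seq d₁ ⇓var)))
      rest : Loop (suc i) s₂
      rest = loop d (suc i) s₂ (≡.trans (≡.sym (ℕ.+-suc i d)) eq) (frame-trans F F₂)
        (≡.trans (updateVar-same (vars s₁) x _) (≡.trans (cong (_+ 1) (≡.trans (var= F₁ x {px}) x=)) (ℕ.+-comm i 1)))
        (≡.trans (updateVar-other (vars s₁) x _ b b≢x) (≡.trans (var= F₁ b {pb}) b=))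
        (h₁ _)
    whole : Loop 0 s₀
    whole = loop N 0 s₀ ≡.refl F₀ (updateVar-same (vars s) x 0) (updateVar-other (vars s) x 0 b b≢x) I₀
    ∑g : sumᴺ N g ≡ c * sumᴺ N p + N * 7
    ∑g = ≡.trans (sumᴺ-+ N (λ i → c * p i) (λ _ → 7)) (cong₂ _+_ (sumᴺ-*ˡ N c p) (sumᴺ-const N 7))
    N≤∑p : N ≤ sumᴺ N p
    N≤∑p = ≤-trans (≤-reflexive (≡.sym (≡.trans (sumᴺ-const N 1) (ℕ.*-identityʳ N)))) (sumᴺ-mono N (λ i _ → 1≤p i))
    total : 2 + Loop.time′ whole ≤ (c + 12) * sumᴺ N p
    total = begin
      2 + Loop.time′ whole              ≡⟨ cong (2 +_) (ℕ.+-identityʳ _) ⟨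
      2 + (Loop.time′ whole + 0)        ≤⟨ +-monoʳ-≤ 2 (Loop.bound′ whole) ⟩
      5 + sumᴺ N g                      ≡⟨ cong (5 +_) ∑g ⟩
      5 + (c * sumᴺ N p + N * 7)        ≤⟨ +-mono-≤ (*-monoʳ-≤ 5 (≤-trans 1≤N N≤∑p)) (+-monoʳ-≤ (c * sumᴺ N p) (*-monoˡ-≤ 7 N≤∑p)) ⟩
      5 * sumᴺ N p + (c * sumᴺ N p + sumᴺ N p * 7)  ≡⟨ collect c (sumᴺ N p) ⟩
      (c + 12) * sumᴺ N p               ∎
      where
      open ≤-Reasoning
      collect : ∀ c y → 5 * y + (c * y + y * 7) ≡ (c + 12) * y
      collect = solve-∀

  run-for : ∀ {q} {x b P s c p N} (I : ℕ → State → Set q)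
    {_ : T (not (assigns P x))} {_ : T (not (assigns P b))} {_ : T (not (b ≡ᵇ x))} →
    vars s b ≡ N → 1 ≤ N → 1 ≤ p →
    I 0 (setVar x 0 s) →
    (∀ i s′ → i < N → Frame (For x b P) s s′ → vars s′ x ≡ i → I i s′ →
      Run P s′ c p (λ s″ → ∀ v → I (suc i) (setVar x v s″))) →
    Run (For x b P) s (c + 12) (N * p) (I N)
  run-for {x = x} {b} {P} {s} {c} {p} I {h₁} {h₂} {h₃} ≡.refl 1≤N 1≤p I₀ step =
    run-grow (vars s b * p) (≤-reflexive (sumᴺ-const (vars s b) p))
      (run-for-sum (λ _ → p) I {h₁} {h₂} {h₃} 1≤N (λ _ → 1≤p) I₀ step)

-- Variables: 3 is L with n ≤ 2 ^ L, 5 is M, 7 is m, 8 is r, 9 and 10 are the row and column,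
-- 11 is the summation index, 12 is j mod m; 4 and 6 are scratch.
-- Ring arrays: 3 is the original C′, 4 is χ, 5 is B χ, 6 and 7 are accumulators.
-- Integer arrays: 1 and 2 mark the rows and the columns to be recomputed.
-- With o = false, X, Y, Z are the transposes of B, A, C′ instead of A, B, C′ themselves.

dot : ℕ → RingExp → Program
dot c e =
  ring c [ lit 0 , lit 0 ]≔ 𝟘 ︔
  For 11 0 (ring c [ lit 0 , lit 0 ]≔ ring c [ lit 0 , lit 0 ] ⊞ e)

Xᴱ Yᴱ Zᴱ : Bool → IntExp → IntExp → RingExp
Xᴱ o e f = ring (sel o 0 1) [ sel o e f , sel o f e ]
Yᴱ o e f = ring (sel o 1 0) [ sel o e f , sel o f e ]
Zᴱ o e f = ring 2 [ sel o e f , sel o f e ]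

mulᴱ : Bool → RingExp → RingExp → RingExp
mulᴱ o x y = sel o x y ⊠ sel o y x

setχ : Program
setχ =
  12 ≔ lit 0 ︔
  For 10 0 (
    (If var 12 ≡' var 8
      Then ring 4 [ lit 0 , var 10 ]≔ 𝟙
      Else (ring 4 [ lit 0 , var 10 ]≔ 𝟘)) ︔
    12 ≔ var 12 ⊕ lit 1 ︔
    (If var 12 ≡' var 7 Then 12 ≔ lit 0 Else skip))

-- Failing rows are only marked during the tests and recomputed afterwards: a row is recomputed once
-- however many tests it fails, and all tests see the same matrix.
setBχ checkRows probe fixRow fixRows testRows phase : Bool → Program
setBχ o = For 9 0 (
  dot 6 (mulᴱ o (Yᴱ o (var 9) (var 11)) (ring 4 [ lit 0 , var 11 ])) ︔
  ring 5 [ lit 0 , var 9 ]≔ ring 6 [ lit 0 , lit 0 ])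
checkRows o = For 9 0 (
  dot 6 (mulᴱ o (Xᴱ o (var 9) (var 11)) (ring 5 [ lit 0 , var 11 ])) ︔
  dot 7 (mulᴱ o (Zᴱ o (var 9) (var 11)) (ring 4 [ lit 0 , var 11 ])) ︔
  (If ring 7 [ lit 0 , lit 0 ] ≈' ring 6 [ lit 0 , lit 0 ]
    Then skip
    Else (int (sel o 1 2) [ lit 0 , var 9 ]≔ lit 1)))
probe o = setχ ︔ setBχ o ︔ checkRows o
testRows o = For 7 5 (For 8 5 (probe o))
fixRow o = For 10 0 (
  dot 6 (mulᴱ o (Xᴱ o (var 9) (var 11)) (Yᴱ o (var 11) (var 10))) ︔
  ring 2 [ sel o (var 9) (var 10) , sel o (var 10) (var 9) ]≔ ring 6 [ lit 0 , lit 0 ])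
fixRows o = For 9 0 (
  If int (sel o 1 2) [ lit 0 , var 9 ] ≡' lit 0 Then skip Else fixRow o)
phase o = testRows o ︔ fixRows o

-- Correctness and running time of one phase.

module Correction {r ℓ} (R : Ring r ℓ) (_≟_ : Decidable (Ring._≈_ R))
  (n : ℕ) (1≤n : 1 ≤ n) (a b : ℕ → ℕ → Ring.Carrier R) where

  open Ring R using (Carrier; _≈_; 0#; 1#; refl; sym; trans; reflexive; +-cong)
  open Algebraic R _≟_
  open Machine R _≟_

  Base : State → Set r
  Base s = vars s 0 ≡ n × (∀ i j → rings s 0 i j ≡ a i j) × (∀ i j → rings s 1 i j ≡ b i j)

  base-frame : ∀ {P s s′} {_ : T (not (assigns P 0))} {_ : T (not (writesRing P 0))}
    {_ : T (not (writesRing P 1))} → Frame P s s′ → Base s → Base s′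
  base-frame {_} {_} {_} {h} {h₀} {h₁} F (n= , a= , b=) =
    ≡.trans (var= F 0 {h}) n= ,
    (λ i j → ≡.trans (ring= F 0 i j {h₀}) (a= i j)) ,
    (λ i j → ≡.trans (ring= F 1 i j {h₁}) (b= i j))

  run-dot : ∀ {c e s} (g : ℕ → Carrier) → costᴿ e ≤ 7 → vars s 0 ≡ n →
    (∀ s′ l → l < n → Frame (dot c e) s s′ → vars s′ 11 ≡ l → ⟦ e ⟧ᴿ s′ ≈ g l) →
    Run (dot c e) s 30 n (λ s′ → rings s′ c 0 0 ≈ sumᴿ n g)
  run-dot {c} {e} {s} g cost n= h =
    -- 30 is 4 for clearing the accumulator, 7 + 7 for a round whose summand costs at most 7, and 12
    -- for the loop.
    run-const 30 (+-monoʳ-≤ 4 (+-monoˡ-≤ 12 (+-monoʳ-≤ 7 cost)))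
    (run-seq {Q = λ s′ → rings s′ c 0 0 ≡ 0#} (run-ring 1≤n (updateArr-same (rings s) c 0 0 0#))
    λ s₁ F₁ h₁ → run-grow n (≤-reflexive (ℕ.*-identityʳ n))
      (run-for (λ i s′ → rings s′ c 0 0 ≈ sumᴿ i g) (≡.trans (var= F₁ 0) n=) 1≤n (s≤s z≤n)
        (reflexive h₁)
        λ i s₂ i<n F₂ x= h₂ → run-ring (s≤s z≤n) λ v →
          trans (reflexive (updateArr-same (rings s₂) c 0 0 _))
                (+-cong h₂ (h s₂ i i<n (frame-seq F₁ F₂) x=))))

  X Y : Bool → ℕ → ℕ → Carrier
  X o i j = sel o a b (sel o i j) (sel o j i)
  Y o i j = sel o b a (sel o i j) (sel o j i)

  Z : Bool → State → ℕ → ℕ → Carrier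
  Z o s i j = rings s 2 (sel o i j) (sel o j i)

  prod : Bool → ℕ → ℕ → Carrier
  prod o i j = sumᴿ n (λ l → mul o (X o i l) (Y o l j))

  eval-mul : ∀ o x y s → ⟦ mulᴱ o x y ⟧ᴿ s ≡ mul o (⟦ x ⟧ᴿ s) (⟦ y ⟧ᴿ s)
  eval-mul true  x y s = ≡.refl
  eval-mul false x y s = ≡.refl

  eval-X : ∀ o e f s → Base s → ⟦ Xᴱ o e f ⟧ᴿ s ≡ X o (⟦ e ⟧ᴵ s) (⟦ f ⟧ᴵ s)
  eval-X true  e f s (_ , a= , _) = a= _ _
  eval-X false e f s (_ , _ , b=) = b= _ _

  eval-Y : ∀ o e f s → Base s → ⟦ Yᴱ o e f ⟧ᴿ s ≡ Y o (⟦ e ⟧ᴵ s) (⟦ f ⟧ᴵ s)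
  eval-Y true  e f s (_ , _ , b=) = b= _ _
  eval-Y false e f s (_ , a= , _) = a= _ _

  eval-Z : ∀ o e f s → ⟦ Zᴱ o e f ⟧ᴿ s ≡ Z o s (⟦ e ⟧ᴵ s) (⟦ f ⟧ᴵ s)
  eval-Z true  e f s = ≡.refl
  eval-Z false e f s = ≡.refl

  run-setχ : ∀ {s m r} → vars s 0 ≡ n → vars s 7 ≡ m → vars s 8 ≡ r →
    Run setχ s 40 n (λ s′ → ∀ j → j < n → rings s′ 4 0 j ≡ χ m r j)
  run-setχ {s} {m} {r} n= m= r= =
    run-const 40 (≤ᵇ⇒≤ _ _ _)
    (run-seq {Q = λ s′ → vars s′ 12 ≡ 0} (run-var 1≤n ≡.refl)
    λ s₁ F₁ h₁ → run-post (λ _ _ → proj₂) (run-grow n (≤-reflexive (ℕ.*-identityʳ n))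
      (run-for (λ i s′ → vars s′ 12 ≡ residue m i × (∀ j → j < i → rings s′ 4 0 j ≡ χ m r j))
        (≡.trans (var= F₁ 0) n=) 1≤n (s≤s z≤n) (h₁ , λ _ ())
        λ i s₂ i<n F₂ x= (c= , old) →
          run-seq {Q = λ s₃ → ∀ j → j < suc i → rings s₃ 4 0 j ≡ χ m r j}
            (run-if {c = 4} (s≤s z≤n)
              (λ t → run-ring (s≤s z≤n) (entries s₂ i x= old (value {s₂} {i} c= (≡.trans (var= F₂ 8) (≡.trans (var= F₁ 8) r=)) t)))
              (λ t → run-ring (s≤s z≤n) (entries s₂ i x= old (value {s₂} {i} c= (≡.trans (var= F₂ 8) (≡.trans (var= F₁ 8) r=)) t))))
          λ s₃ F₃ new → run-seq {Q = λ s₄ → vars s₄ 12 ≡ suc (residue m i)}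
            (run-var (s≤s z≤n) (≡.trans (cong (_+ 1) (≡.trans (var= F₃ 12) c=)) (ℕ.+-comm (residue m i) 1)))
          λ s₄ F₄ c₄ → run-post
            (λ s₅ F₅ c₅ v → c₅ , λ j j≤i → ≡.trans (ring= F₅ 4 0 j) (≡.trans (ring= F₄ 4 0 j) (new j j≤i)))
            (advance s₄ i c₄ (≡.trans (var= F₄ 7) (≡.trans (var= F₃ 7) (≡.trans (var= F₂ 7) (≡.trans (var= F₁ 7) m=))))))))
    where
    value : ∀ {s i t} → vars s 12 ≡ residue m i → vars s 8 ≡ r →
      (vars s 12 ≡ᵇ vars s 8) ≡ t → χ m r i ≡ (if t then 1# else 0#)
    value p q t rewrite p | q | t = ≡.refl
    entries : ∀ s i {v} → vars s 10 ≡ i → (∀ j → j < i → rings s 4 0 j ≡ χ m r j) → χ m r i ≡ v →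
      ∀ j → j < suc i → updateArr (rings s) 4 0 (vars s 10) v 4 0 j ≡ χ m r j
    entries s i ≡.refl old eq j j<1+i with m≤n⇒m<n∨m≡n (s≤s⁻¹ j<1+i)
    ... | inj₁ j<i = ≡.trans (updateArr-column (rings s) 4 0 (vars s 10) _ 4 0 j (<⇒≢ j<i)) (old j j<i)
    ... | inj₂ ≡.refl = ≡.trans (updateArr-same (rings s) 4 0 (vars s 10) _) (≡.sym eq)
    advance : ∀ s i → vars s 12 ≡ suc (residue m i) → vars s 7 ≡ m →
      Run (If var 12 ≡' var 7 Then 12 ≔ lit 0 Else skip) s 5 1 (λ s′ → vars s′ 12 ≡ residue m (suc i))
    advance s i c= m= = run-if (s≤s z≤n)
      (λ t → run-var (s≤s z≤n) (wrap t))
      (λ t → run-const 2 z≤n (run-skip (≡.trans c= (keep t))))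
      where
      wrap : (vars s 12 ≡ᵇ vars s 7) ≡ true → 0 ≡ residue m (suc i)
      wrap t rewrite c= | m= | t = ≡.refl
      keep : (vars s 12 ≡ᵇ vars s 7) ≡ false → suc (residue m i) ≡ residue m (suc i)
      keep t rewrite c= | m= | t = ≡.refl

  run-setBχ : ∀ o {s m r} → Base s → (∀ j → j < n → rings s 4 0 j ≡ χ m r j) →
    Run (setBχ o) s 50 (n * n)
      (λ s′ → ∀ l → l < n → rings s′ 5 0 l ≈ sumᴿ n (λ j → mul o (Y o l j) (χ m r j)))
  run-setBχ o {s} {m} {r} base χ= =
    run-const 50 (≤ᵇ⇒≤ _ _ _)
    (run-for (λ i s′ → ∀ l → l < i → rings s′ 5 0 l ≈ v l) (proj₁ base) 1≤n 1≤n (λ _ ())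
      λ i s₁ i<n F₁ x= old → run-seq
        (run-dot (λ j → mul o (Y o i j) (χ m r j)) (cost o) (≡.trans (var= F₁ 0) (proj₁ base))
          λ s₂ j j<n F₂ y= → trans (reflexive (eval-mul o _ _ s₂))
            (mul-cong o
              (reflexive (≡.trans (eval-Y o (var 9) (var 11) s₂ (base-frame F₂ (base-frame F₁ base)))
                (cong₂ (Y o) (≡.trans (var= F₂ 9) x=) y=)))
              (reflexive (≡.trans (cong (rings s₂ 4 0) y=)
                (≡.trans (ring= F₂ 4 0 j) (≡.trans (ring= F₁ 4 0 j) (χ= j j<n)))))))
        λ s₂ F₂ h₂ → run-ring 1≤n λ _ → entries s₂ i (≡.trans (var= F₂ 9) x=)
          (λ l l<i → trans (reflexive (ring= F₂ 5 0 l)) (old l l<i)) h₂)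
    where
    v : ℕ → Carrier
    v l = sumᴿ n (λ j → mul o (Y o l j) (χ m r j))
    cost : ∀ o → costᴿ (mulᴱ o (Yᴱ o (var 9) (var 11)) (ring 4 [ lit 0 , var 11 ])) ≤ 7
    cost true  = ≤-refl
    cost false = ≤-refl
    entries : ∀ s i {y} → vars s 9 ≡ i → (∀ l → l < i → rings s 5 0 l ≈ v l) → y ≈ v i →
      ∀ l → l < suc i → updateArr (rings s) 5 0 (vars s 9) y 5 0 l ≈ v l
    entries s i ≡.refl old eq l l<1+i with m≤n⇒m<n∨m≡n (s≤s⁻¹ l<1+i)
    ... | inj₁ l<i = trans (reflexive (updateArr-column (rings s) 5 0 (vars s 9) _ 5 0 l (<⇒≢ l<i))) (old l l<i)
    ... | inj₂ ≡.refl = trans (reflexive (updateArr-same (rings s) 5 0 (vars s 9) _)) eq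

  -- The lexicographic order in which the two nested loops perform the tests.
  Before : ℕ → ℕ → ℕ → ℕ → Set
  Before m′ r′ m r = m < m′ ⊎ (m ≡ m′ × r < r′)

  errors : Bool → (ℕ → ℕ → Carrier) → ℕ → ℕ
  errors o z i = sumᴺ n (λ j → mismatch (z i j) (prod o i j))

  module _ (o : Bool) (M : ℕ) (1≤M : 1 ≤ M) (z : ℕ → ℕ → Carrier) where

    open Oriented o using (Passes; matvec-assoc)

    mark : State → ℕ → ℕ
    mark s i = ints s (sel o 1 2) 0 i

    -- The left alternative gives completeness: whatever stays unmarked has passed everything. The
    -- right one gives the cost: every recomputed row can be charged to an error it really contains.
    Status : ℕ → ℕ → State → ℕ → Set ℓ
    Status m′ r′ s i =
      (mark s i ≡ 0 × (∀ m r → r < M → Before m′ r′ m r → Passes n (z i) (prod o i) m r)) ⊎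
      (mark s i ≡ 1 × 1 ≤ errors o z i)

    status-mark : ∀ {m r} s s′ i → mark s′ i ≡ mark s i → Status m r s i → Status m r s′ i
    status-mark s s′ i eq (inj₁ (p , q)) = inj₁ (≡.trans eq p , q)
    status-mark s s′ i eq (inj₂ (p , q)) = inj₂ (≡.trans eq p , q)

    fails⇒error : ∀ {m r i} → ¬ Passes n (z i) (prod o i) m r → 1 ≤ errors o z i
    fails⇒error {m} {r} {i} ¬passes = ℕ.n≢0⇒n>0 λ e≡0 → ¬passes
      (sumᴿ-cong n λ j j<n → mul-cong o (mismatch≡0⇒≈ (ℕ.n≤0⇒n≡0
        (subst (mismatch (z i j) (prod o i j) ≤_) e≡0 (term≤sumᴺ n (λ j → mismatch (z i j) (prod o i j)) j<n)))) refl)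

    run-checkRows : ∀ {s m r} → Base s → (∀ i j → Z o s i j ≡ z i j) →
      (∀ j → j < n → rings s 4 0 j ≡ χ m r j) →
      (∀ l → l < n → rings s 5 0 l ≈ sumᴿ n (λ j → mul o (Y o l j) (χ m r j))) →
      (∀ i → i < n → Status m r s i) →
      Run (checkRows o) s 90 (n * n) (λ s′ → ∀ i → i < n → Status m (suc r) s′ i)
    run-checkRows {s} {m} {r} base z= χ= v= status =
      run-post (λ _ _ (new , _) → new)
      (run-const 90 (≤ᵇ⇒≤ _ _ _)
      (run-for (λ i′ s′ → (∀ i → i < i′ → Status m (suc r) s′ i) × (∀ i → i′ ≤ i → i < n → Status m r s′ i))
        (proj₁ base) 1≤n 1≤n ((λ _ ()) , λ i _ → status i)
        λ i s₁ i<n F₁ x= (new , old) → run-seq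
          (run-dot (λ l → mul o (X o i l) (sumᴿ n (λ j → mul o (Y o l j) (χ m r j)))) (costX o)
            (≡.trans (var= F₁ 0) (proj₁ base))
            λ s₂ l l<n F₂ y= → trans (reflexive (eval-mul o _ _ s₂)) (mul-cong o
              (reflexive (≡.trans (eval-X o (var 9) (var 11) s₂ (base-frame F₂ (base-frame F₁ base)))
                (cong₂ (X o) (≡.trans (var= F₂ 9) x=) y=)))
              (trans (reflexive (≡.trans (cong (rings s₂ 5 0) y=) (≡.trans (ring= F₂ 5 0 l) (ring= F₁ 5 0 l)))) (v= l l<n))))
        λ s₂ F₂ h₂ → run-seq
          (run-dot (λ j → mul o (z i j) (χ m r j)) (costZ o)
            (≡.trans (var= F₂ 0) (≡.trans (var= F₁ 0) (proj₁ base)))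
            λ s₃ j j<n F₃ y= → trans (reflexive (eval-mul o _ _ s₃)) (mul-cong o
              (reflexive (≡.trans (eval-Z o (var 9) (var 11) s₃)
                (≡.trans (cong₂ (Z o s₃) (≡.trans (var= F₃ 9) (≡.trans (var= F₂ 9) x=)) y=)
                (≡.trans (ring= F₃ 2 _ _) (≡.trans (ring= F₂ 2 _ _) (≡.trans (ring= F₁ 2 _ _) (z= i j)))))))
              (reflexive (≡.trans (cong (rings s₃ 4 0) y=)
                (≡.trans (ring= F₃ 4 0 j) (≡.trans (ring= F₂ 4 0 j) (≡.trans (ring= F₁ 4 0 j) (χ= j j<n))))))))
        λ s₃ F₃ h₃ → record-test s₃ i i<n (≡.trans (var= F₃ 9) (≡.trans (var= F₂ 9) x=))
          (trans (reflexive (ring= F₃ 6 0 0)) (trans h₂ (matvec-assoc n (X o i) (Y o) (χ m r)))) h₃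
          (λ i′ i′<i → status-mark s₁ s₃ i′ (≡.trans (int= F₃ (sel o 1 2) _ _) (int= F₂ (sel o 1 2) _ _)) (new i′ i′<i))
          (λ i′ i≤i′ i′<n → status-mark s₁ s₃ i′ (≡.trans (int= F₃ (sel o 1 2) _ _) (int= F₂ (sel o 1 2) _ _)) (old i′ i≤i′ i′<n))))
      where
      costX : ∀ o → costᴿ (mulᴱ o (Xᴱ o (var 9) (var 11)) (ring 5 [ lit 0 , var 11 ])) ≤ 7
      costX true  = ≤-refl
      costX false = ≤-refl
      costZ : ∀ o → costᴿ (mulᴱ o (Zᴱ o (var 9) (var 11)) (ring 4 [ lit 0 , var 11 ])) ≤ 7
      costZ true  = ≤-refl
      costZ false = ≤-refl
      record-test : ∀ s i → i < n → vars s 9 ≡ i →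
        rings s 6 0 0 ≈ sumᴿ n (λ j → mul o (prod o i j) (χ m r j)) →
        rings s 7 0 0 ≈ sumᴿ n (λ j → mul o (z i j) (χ m r j)) →
        (∀ i′ → i′ < i → Status m (suc r) s i′) → (∀ i′ → i ≤ i′ → i′ < n → Status m r s i′) →
        Run (If ring 7 [ lit 0 , lit 0 ] ≈' ring 6 [ lit 0 , lit 0 ]
             Then skip Else (int (sel o 1 2) [ lit 0 , var 9 ]≔ lit 1)) s 11 n
          (λ s′ → ℕ → (∀ i′ → i′ < suc i → Status m (suc r) s′ i′) ×
                      (∀ i′ → suc i ≤ i′ → i′ < n → Status m r s′ i′))
      record-test s i i<n ≡.refl p q new old = run-if 1≤n
        (λ t → run-const 4 z≤n (run-skip λ _ → passed t , λ i′ i<i′ → old i′ (<⇒≤ i<i′)))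
        (λ t → run-int 1≤n λ _ → failed t ,
          λ i′ i<i′ i′<n → status-mark s s′ i′ (unmarked (≡.≢-sym (<⇒≢ i<i′))) (old i′ (<⇒≤ i<i′) i′<n))
        where
        s′ = state (vars s) (updateArr (ints s) (sel o 1 2) 0 (vars s 9) 1) (rings s)
        unmarked : ∀ {i′} → i′ ≢ i → mark s′ i′ ≡ mark s i′
        unmarked {i′} = updateArr-column (ints s) (sel o 1 2) 0 i 1 (sel o 1 2) 0 i′
        passed : does (rings s 7 0 0 ≟ rings s 6 0 0) ≡ true → ∀ i′ → i′ < suc i → Status m (suc r) s i′
        passed t i′ i′<1+i with m≤n⇒m<n∨m≡n (s≤s⁻¹ i′<1+i)
        ... | inj₁ i′<i = new i′ i′<i
        ... | inj₂ ≡.refl with rings s 7 0 0 ≟ rings s 6 0 0 | t | old i ≤-refl i<n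
        ...   | yes _  | _ | inj₂ marked = inj₂ marked
        ...   | yes eq | _ | inj₁ (m≡0 , before) = inj₁ (m≡0 , extend)
          where
          extend : ∀ m′ r′ → r′ < M → Before m (suc r) m′ r′ → Passes n (z i) (prod o i) m′ r′
          extend m′ r′ r′<M (inj₁ m′<m) = before m′ r′ r′<M (inj₁ m′<m)
          extend m′ r′ r′<M (inj₂ (≡.refl , r′<1+r)) with m≤n⇒m<n∨m≡n (s≤s⁻¹ r′<1+r)
          ... | inj₁ r′<r = before m′ r′ r′<M (inj₂ (≡.refl , r′<r))
          ... | inj₂ ≡.refl = trans (sym q) (trans eq p)
        failed : does (rings s 7 0 0 ≟ rings s 6 0 0) ≡ false → ∀ i′ → i′ < suc i → Status m (suc r) s′ i′
        failed t i′ i′<1+i with m≤n⇒m<n∨m≡n (s≤s⁻¹ i′<1+i)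
        ... | inj₁ i′<i = status-mark s s′ i′ (unmarked (<⇒≢ i′<i)) (new i′ i′<i)
        ... | inj₂ ≡.refl with rings s 7 0 0 ≟ rings s 6 0 0 | t
        ...   | no neq | _ = inj₂ (updateArr-same (ints s) (sel o 1 2) 0 i 1 ,
                  fails⇒error {m} {r} λ passes → neq (trans q (trans passes (sym p))))

    run-probe : ∀ {s m r} → Base s → (∀ i j → Z o s i j ≡ z i j) → vars s 7 ≡ m → vars s 8 ≡ r →
      (∀ i → i < n → Status m r s i) →
      Run (probe o) s 180 (n * n) (λ s′ → ∀ i → i < n → Status m (suc r) s′ i)
    run-probe {s} base z= m= r= status = run-seq
      (run-grow (n * n) (c≤c*p 1≤n) (run-setχ (proj₁ base) m= r=))
      λ s₁ F₁ χ= → run-seq (run-setBχ o (base-frame F₁ base) χ=)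
      λ s₂ F₂ v= → run-checkRows (base-frame F₂ (base-frame F₁ base))
        (λ i j → ≡.trans (ring= F₂ 2 _ _) (≡.trans (ring= F₁ 2 _ _) (z= i j)))
        (λ j j<n → ≡.trans (ring= F₂ 4 0 j) (χ= j j<n)) v=
        (λ i i<n → status-mark s s₂ i (≡.trans (int= F₂ (sel o 1 2) _ _) (int= F₁ (sel o 1 2) _ _)) (status i i<n))

    1≤n² : 1 ≤ n * n
    1≤n² = *-mono-≤ 1≤n 1≤n

    run-testRows : ∀ {s} → Base s → vars s 5 ≡ M → (∀ i j → Z o s i j ≡ z i j) →
      (∀ i → i < n → mark s i ≡ 0) →
      Run (testRows o) s 204 (M * (M * (n * n))) (λ s′ → ∀ i → i < n → Status M 0 s′ i)
    run-testRows {s} base M= z= unmarked =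
      run-for (λ m s′ → ∀ i → i < n → Status m 0 s′ i) M= 1≤M (*-mono-≤ 1≤M 1≤n²)
        (λ i i<n → inj₁ (unmarked i i<n , λ { _ _ _ (inj₁ ()) ; _ _ _ (inj₂ (_ , ())) }))
      λ m s₁ m<M F₁ m= h₁ → run-post (λ s₂ _ h₂ _ i i<n → next s₂ i (h₂ i i<n))
        (run-for (λ r s′ → ∀ i → i < n → Status m r s′ i) (≡.trans (var= F₁ 5) M=) 1≤M 1≤n² h₁
        λ r s₂ r<M F₂ r= h₂ → run-post (λ _ _ h _ → h)
          (run-probe (base-frame F₂ (base-frame F₁ base))
            (λ i j → ≡.trans (ring= F₂ 2 _ _) (≡.trans (ring= F₁ 2 _ _) (z= i j)))
            (≡.trans (var= F₂ 7) m=) r= h₂))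
      where
      -- The finished inner loop moves the position from (m, M) to (m + 1, 0). Only residues below M
      -- were tried, which is why `Status` restricts r.
      next : ∀ {m} s i → Status m M s i → Status (suc m) 0 s i
      next s i (inj₂ marked) = inj₂ marked
      next {m} s i (inj₁ (m≡0 , before)) = inj₁ (m≡0 , extend)
        where
        extend : ∀ m′ r′ → r′ < M → Before (suc m) 0 m′ r′ → Passes n (z i) (prod o i) m′ r′
        extend m′ r′ r′<M (inj₂ (_ , ()))
        extend m′ r′ r′<M (inj₁ m′<1+m) with m≤n⇒m<n∨m≡n (s≤s⁻¹ m′<1+m)
        ... | inj₁ m′<m = before m′ r′ r′<M (inj₁ m′<m)
        ... | inj₂ m′≡m = before m′ r′ r′<M (inj₂ (m′≡m , r′<M))

    eval-sel : ∀ o e f s → ⟦ sel o e f ⟧ᴵ s ≡ sel o (⟦ e ⟧ᴵ s) (⟦ f ⟧ᴵ s)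
    eval-sel true  e f s = ≡.refl
    eval-sel false e f s = ≡.refl

    Z-row : ∀ o (m : Arrays Carrier) i j v {i′} j′ → i′ ≢ i →
      updateArr m 2 (sel o i j) (sel o j i) v 2 (sel o i′ j′) (sel o j′ i′) ≡ m 2 (sel o i′ j′) (sel o j′ i′)
    Z-row true  m i j v j′ = updateArr-row m 2 i j v 2 _ j′
    Z-row false m i j v j′ = updateArr-column m 2 j i v 2 j′ _

    Z-column : ∀ o (m : Arrays Carrier) i j v i′ {j′} → j′ ≢ j →
      updateArr m 2 (sel o i j) (sel o j i) v 2 (sel o i′ j′) (sel o j′ i′) ≡ m 2 (sel o i′ j′) (sel o j′ i′)
    Z-column true  m i j v i′ = updateArr-column m 2 i j v 2 i′ _
    Z-column false m i j v i′ = updateArr-row m 2 j i v 2 _ i′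

    run-fixRow : ∀ {s i} → Base s → vars s 9 ≡ i →
      Run (fixRow o) s 48 (n * n) (λ s′ → (∀ j → j < n → Z o s′ i j ≈ prod o i j) ×
        (∀ i′ j → i′ ≢ i → Z o s′ i′ j ≡ Z o s i′ j))
    run-fixRow {s} {i} base i= =
      run-for (λ j′ s′ → (∀ j → j < j′ → Z o s′ i j ≈ prod o i j) × (∀ i′ j → i′ ≢ i → Z o s′ i′ j ≡ Z o s i′ j))
        (proj₁ base) 1≤n 1≤n ((λ _ ()) , λ _ _ _ → ≡.refl)
      λ j s₁ j<n F₁ j= (new , old) → run-seq
        (run-dot (λ l → mul o (X o i l) (Y o l j)) (cost o) (≡.trans (var= F₁ 0) (proj₁ base))
          λ s₂ l l<n F₂ l= → trans (reflexive (eval-mul o _ _ s₂)) (mul-cong o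
            (reflexive (≡.trans (eval-X o (var 9) (var 11) s₂ (base-frame F₂ (base-frame F₁ base)))
              (cong₂ (X o) (≡.trans (var= F₂ 9) (≡.trans (var= F₁ 9) i=)) l=)))
            (reflexive (≡.trans (eval-Y o (var 11) (var 10) s₂ (base-frame F₂ (base-frame F₁ base)))
              (cong₂ (Y o) l= (≡.trans (var= F₂ 10) j=))))))
      λ s₂ F₂ h₂ → run-const 6 (cost′ o) (run-ring 1≤n λ _ →
        let i₂ = ≡.trans (var= F₂ 9) (≡.trans (var= F₁ 9) i=)
            j₂ = ≡.trans (var= F₂ 10) j=
            e = ≡.trans (eval-sel o (var 9) (var 10) s₂) (cong₂ (sel o) i₂ j₂)
            f = ≡.trans (eval-sel o (var 10) (var 9) s₂) (cong₂ (sel o) j₂ i₂) in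
        written s₂ j e f h₂ (λ j′ j′<j → trans (reflexive (ring= F₂ 2 _ _)) (new j′ j′<j)) ,
        λ i′ j′ i′≢i → ≡.trans (untouched s₂ j e f i′ j′ i′≢i) (≡.trans (ring= F₂ 2 _ _) (old i′ j′ i′≢i)))
      where
      cost : ∀ o → costᴿ (mulᴱ o (Xᴱ o (var 9) (var 11)) (Yᴱ o (var 11) (var 10))) ≤ 7
      cost true  = ≤-refl
      cost false = ≤-refl
      cost′ : ∀ o → 1 + costᴵ (sel o (var 9) (var 10)) + costᴵ (sel o (var 10) (var 9)) + 3 ≤ 6
      cost′ true  = ≤-refl
      cost′ false = ≤-refl
      written : ∀ s j {e f v} → e ≡ sel o i j → f ≡ sel o j i → v ≈ prod o i j →
        (∀ j′ → j′ < j → Z o s i j′ ≈ prod o i j′) →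
        ∀ j′ → j′ < suc j → updateArr (rings s) 2 e f v 2 (sel o i j′) (sel o j′ i) ≈ prod o i j′
      written s j ≡.refl ≡.refl eq new j′ j′<1+j with m≤n⇒m<n∨m≡n (s≤s⁻¹ j′<1+j)
      ... | inj₁ j′<j = trans (reflexive (Z-column o (rings s) i j _ i (<⇒≢ j′<j))) (new j′ j′<j)
      ... | inj₂ ≡.refl = trans (reflexive (updateArr-same (rings s) 2 (sel o i j) (sel o j i) _)) eq
      untouched : ∀ s j {e f v} → e ≡ sel o i j → f ≡ sel o j i → ∀ i′ j′ → i′ ≢ i →
        updateArr (rings s) 2 e f v 2 (sel o i′ j′) (sel o j′ i′) ≡ Z o s i′ j′
      untouched s j ≡.refl ≡.refl i′ j′ i′≢i = Z-row o (rings s) i j _ j′ i′≢i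

    Fixed : State → State → ℕ → Set (r ⊔ˡ ℓ)
    Fixed s s′ i = (mark s i ≡ 0 × (∀ j → Z o s′ i j ≡ Z o s i j)) ⊎ (∀ j → j < n → Z o s′ i j ≈ prod o i j)

    -- An unmarked row costs a constant and a marked one O(n²). The marks are left inside the bound
    -- so that `run-phase` can compare them with error counts.
    run-fixRows : ∀ {s} → Base s →
      Run (fixRows o) s 65 (sumᴺ n (λ i → 1 + mark s i * (n * n))) (λ s′ → ∀ i → i < n → Fixed s s′ i)
    run-fixRows {s} base =
      run-post (λ s′ _ h → proj₁ (subst (λ N → I N s′) (proj₁ base) h))
      (run-grow _ (≤-reflexive (cong (λ N → sumᴺ N (λ i → 1 + mark s i * (n * n))) (proj₁ base)))
      (run-for-sum (λ i → 1 + mark s i * (n * n)) I (subst (1 ≤_) (≡.sym (proj₁ base)) 1≤n) (λ _ → s≤s z≤n)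
        ((λ _ ()) , λ _ _ _ → ≡.refl)
      λ i s₁ i<N F₁ i= (new , old) → run-if {c = 48} (s≤s z≤n)
        (λ t → run-const 48 z≤n (run-skip λ _ →
          snoc s₁ i new (inj₁ (≡.trans (≡.sym (int= F₁ (sel o 1 2) _ _)) (zero-mark s₁ i i= t) , λ j → old i j ≤-refl)) ,
          λ i′ j i<i′ → old i′ j (<⇒≤ i<i′)))
        (λ t → run-grow (1 + mark s i * (n * n))
          (ℕ.m≤n⇒m≤1+n (ℕ.m≤n*m (n * n) (mark s i) {{≢-nonZero λ m≡0 →
            nonzero-mark s₁ i i= t (≡.trans (int= F₁ (sel o 1 2) _ _) m≡0)}}))
          (run-post
            (λ s₂ F₂ (row , others) _ →
              snoc s₂ i (λ i′ i′<i → keep s₁ s₂ i′ (others i′) (<⇒≢ i′<i) (new i′ i′<i)) (inj₂ row) ,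
              λ i′ j i<i′ → ≡.trans (others i′ j (≡.≢-sym (<⇒≢ i<i′))) (old i′ j (<⇒≤ i<i′)))
            (run-fixRow (base-frame F₁ base) i=)))))
      where
      I : ℕ → State → Set (r ⊔ˡ ℓ)
      I i′ s′ = (∀ i → i < i′ → Fixed s s′ i) × (∀ i j → i′ ≤ i → Z o s′ i j ≡ Z o s i j)
      snoc : ∀ s′ i → (∀ i′ → i′ < i → Fixed s s′ i′) → Fixed s s′ i → ∀ i′ → i′ < suc i → Fixed s s′ i′
      snoc s′ i h h′ i′ i′<1+i with m≤n⇒m<n∨m≡n (s≤s⁻¹ i′<1+i)
      ... | inj₁ i′<i = h i′ i′<i
      ... | inj₂ ≡.refl = h′
      keep : ∀ s₁ s₂ {i} i′ → (∀ j → i′ ≢ i → Z o s₂ i′ j ≡ Z o s₁ i′ j) → i′ ≢ i → Fixed s s₁ i′ → Fixed s s₂ i′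
      keep s₁ s₂ i′ same i′≢i (inj₁ (m≡0 , h)) = inj₁ (m≡0 , λ j → ≡.trans (same j i′≢i) (h j))
      keep s₁ s₂ i′ same i′≢i (inj₂ h) = inj₂ λ j j<n → trans (reflexive (same j i′≢i)) (h j j<n)
      zero-mark : ∀ s i → vars s 9 ≡ i → (ints s (sel o 1 2) 0 (vars s 9) ≡ᵇ 0) ≡ true → mark s i ≡ 0
      zero-mark s i ≡.refl t = ≡ᵇ⇒≡ _ 0 (subst T (≡.sym t) _)
      nonzero-mark : ∀ s i → vars s 9 ≡ i → (ints s (sel o 1 2) 0 (vars s 9) ≡ᵇ 0) ≡ false → mark s i ≢ 0
      nonzero-mark s i ≡.refl t m≡0 = subst T t (≡⇒≡ᵇ _ 0 m≡0)

    -- A row that is still wrong falls under the second alternative; having passed all tests, it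
    -- cannot be light by `light-row-correct`.
    Corrected : State → ℕ → Set (r ⊔ˡ ℓ)
    Corrected s i = (∀ j → j < n → Z o s i j ≈ prod o i j) ⊎
      ((∀ j → Z o s i j ≡ z i j) × (∀ m r → m < M → r < M → Passes n (z i) (prod o i) m r))

    run-phase : ∀ {s} k → sumᴺ n (errors o z) ≤ k → Base s → vars s 5 ≡ M →
      (∀ i j → Z o s i j ≡ z i j) → (∀ i → i < n → mark s i ≡ 0) →
      Run (phase o) s 269 (M * (M * (n * n)) + suc k * (n * n)) (λ s′ → ∀ i → i < n → Corrected s′ i)
    run-phase {s} k ∑≤k base M= z= unmarked = run-seq
      (run-grow (M * (M * (n * n)) + suc k * (n * n)) (ℕ.m≤m+n _ _) (run-testRows base M= z= unmarked))
      λ s₁ F₁ status → run-grow _ (≤-trans (bound s₁ status) (ℕ.m≤n+m _ (M * (M * (n * n)))))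
        (run-post (λ s₂ F₂ fixed i i<n → corrected s₁ s₂ i (λ j → ≡.trans (ring= F₁ 2 _ _) (z= i j)) (status i i<n) (fixed i i<n))
          (run-fixRows (base-frame F₁ base)))
      where
      mark≤errors : ∀ s i → Status M 0 s i → mark s i ≤ errors o z i
      mark≤errors s i (inj₁ (m≡0 , _)) = ≤-trans (≤-reflexive m≡0) z≤n
      mark≤errors s i (inj₂ (m≡1 , 1≤e)) = ≤-trans (≤-reflexive m≡1) 1≤e
      -- Marked rows are charged to errors, at most k n² in all; the additional n² of `suc k` pays
      -- for scanning the n marks.
      bound : ∀ s → (∀ i → i < n → Status M 0 s i) →
        sumᴺ n (λ i → 1 + mark s i * (n * n)) ≤ suc k * (n * n)
      bound s status = begin
        sumᴺ n (λ i → 1 + mark s i * (n * n))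
          ≤⟨ sumᴺ-mono n (λ i i<n → s≤s (≤-trans (*-monoˡ-≤ (n * n) (mark≤errors s i (status i i<n)))
               (≤-reflexive (ℕ.*-comm (errors o z i) (n * n))))) ⟩
        sumᴺ n (λ i → 1 + n * n * errors o z i)
          ≡⟨ sumᴺ-+ n (λ _ → 1) (λ i → n * n * errors o z i) ⟩
        sumᴺ n (λ _ → 1) + sumᴺ n (λ i → n * n * errors o z i)
          ≡⟨ cong₂ _+_ (sumᴺ-const n 1) (sumᴺ-*ˡ n (n * n) (errors o z)) ⟩
        n * 1 + n * n * sumᴺ n (errors o z)
          ≤⟨ +-mono-≤ (*-monoʳ-≤ n 1≤n) (*-monoʳ-≤ (n * n) ∑≤k) ⟩
        n * n + n * n * k
          ≡⟨ cong (n * n +_) (ℕ.*-comm (n * n) k) ⟩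
        suc k * (n * n) ∎
        where open ≤-Reasoning
      corrected : ∀ s₁ s₂ i → (∀ j → Z o s₁ i j ≡ z i j) → Status M 0 s₁ i → Fixed s₁ s₂ i → Corrected s₂ i
      corrected s₁ s₂ i z= _ (inj₂ row) = inj₁ row
      corrected s₁ s₂ i z= (inj₁ (_ , passes)) (inj₁ (_ , same)) =
        inj₂ ((λ j → ≡.trans (same j) (z= j)) , λ m r m<M r<M → passes m r r<M (inj₁ m<M))
      corrected s₁ s₂ i z= (inj₂ (m≡1 , _)) (inj₁ (m≡0 , _)) with ≡.trans (≡.sym m≡1) m≡0
      ... | ()

-- The marks locate only suspicious rows and columns, so the erroneous positions are found at the
-- end, by comparing the corrected matrix with a copy of C′.
copyMatrix computeLog computeModuli correct report main : Program
copyMatrix = For 9 0 (For 10 0 (ring 3 [ var 9 , var 10 ]≔ ring 2 [ var 9 , var 10 ]))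
computeLog =
  3 ≔ lit 0 ︔
  4 ≔ lit 1 ︔
  For 9 0 (If var 4 <' var 9 ⊕ lit 1
    Then (4 ≔ var 4 ⊕ var 4 ︔ 3 ≔ var 3 ⊕ lit 1)
    Else skip)
-- For growing i ≤ k and σ = ⌊√i⌋, variables 4, 6, 5 hold (σ + 1)², 2 σ + 3 and 2 σ L + 4.
computeModuli =
  4 ≔ lit 1 ︔
  6 ≔ lit 3 ︔
  5 ≔ lit 4 ︔
  For 9 1 (If var 9 ⊕ lit 1 <' var 4
    Then skip
    Else (4 ≔ var 4 ⊕ var 6 ︔ 6 ≔ var 6 ⊕ lit 2 ︔ 5 ≔ var 5 ⊕ (var 3 ⊕ var 3)))
correct = phase true ︔ phase false
report = For 9 0 (For 10 0 (
  If ring 3 [ var 9 , var 10 ] ≈' ring 2 [ var 9 , var 10 ]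
    Then skip
    Else (
      int 0 [ var 2 , lit 0 ]≔ var 9 ︔
      int 0 [ var 2 , lit 1 ]≔ var 10 ︔
      2 ≔ var 2 ⊕ lit 1)))
main =
  -- When n = 0 or k = 0 the rate k n² vanishes and even reading the matrix could exceed the bound;
  -- the input is then already correct and the initial report is empty.
  If var 0 ≡' lit 0 Then skip Else (
  If var 1 ≡' lit 0 Then skip Else (
  copyMatrix ︔ computeLog ︔ computeModuli ︔ correct ︔ report))

applyUpTo-cong : ∀ {a} {X : Set a} {f g : ℕ → X} n → (∀ i → i < n → f i ≡ g i) → applyUpTo f n ≡ applyUpTo g n
applyUpTo-cong zero h = ≡.refl
applyUpTo-cong (suc n) h = cong₂ _∷_ (h 0 (s≤s z≤n)) (applyUpTo-cong n (λ i i<n → h (suc i) (s≤s i<n)))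

<ᵇ-true : ∀ {m n} → (m <ᵇ n) ≡ true → m < n
<ᵇ-true {m} {n} t = ℕ.<ᵇ⇒< m n (subst T (≡.sym t) _)

<ᵇ-false : ∀ {m n} → (m <ᵇ n) ≡ false → n ≤ m
<ᵇ-false {m} {n} t = ℕ.≮⇒≥ λ m<n → subst T t (ℕ.<⇒<ᵇ m<n)

-- The range 2 + 2 h of `common-multiple-≥2^` at h = σ L + 1.
moduli : ℕ → ℕ → ℕ
moduli σ L = 2 + (suc (σ * L) + suc (σ * L))

polylog rate : ℕ → ℕ → ℕ
polylog n k = 1 + ⌊log₂ n ⌋ + ⌊log₂ k ⌋
rate n k = polylog n k ^ 2 * (1 ⊔ k * n ^ 2)

-- Estimates for the total running time.

1≤polylog^2 : ∀ n k → 1 ≤ polylog n k ^ 2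
1≤polylog^2 n k = ℕ.m^n>0 (polylog n k) 2

1≤rate : ∀ n k → 1 ≤ rate n k
1≤rate n k = *-mono-≤ (1≤polylog^2 n k) (ℕ.m≤m⊔n 1 (k * n ^ 2))

kn²≤rate : ∀ n k → k * (n * n) ≤ rate n k
kn²≤rate n k = ≤-trans (≤-reflexive (cong (λ x → k * (n * x)) (≡.sym (ℕ.*-identityʳ n))))
  (≤-trans (ℕ.m≤n⊔m 1 (k * n ^ 2)) (ℕ.m≤n*m _ (polylog n k ^ 2) {{>-nonZero (1≤polylog^2 n k)}}))

module _ {n k : ℕ} (1≤n : 1 ≤ n) (1≤k : 1 ≤ k) where

  n²≤rate : n * n ≤ rate n k
  n²≤rate = ≤-trans (ℕ.m≤n*m (n * n) k {{>-nonZero 1≤k}}) (kn²≤rate n k)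

  k≤rate : k ≤ rate n k
  k≤rate = ≤-trans (ℕ.m≤m*n k (n * n) {{>-nonZero (*-mono-≤ 1≤n 1≤n)}}) (kn²≤rate n k)

  -- From 2 ^ L ≤ 4 n follows L ≤ 2 + ⌊log₂ n⌋, and the leading 1 in `polylog`, doubled, absorbs the
  -- 2.
  log-bound : ∀ {L} → 2 ^ L ≤ 1 + (n + n) → L ≤ 2 * polylog n k
  log-bound {L} h = begin
    L                         ≡⟨ ⌊log₂[2^n]⌋≡n L ⟨
    ⌊log₂ (2 ^ L) ⌋           ≤⟨ ⌊log₂⌋-mono-≤ (≤-trans h (≤-trans (+-monoˡ-≤ (n + n) 1≤2n) (≤-reflexive (double n)))) ⟩
    ⌊log₂ (2 * (2 * n)) ⌋     ≡⟨ ⌊log₂[2*b]⌋≡1+⌊log₂b⌋ (2 * n) {{ℕ.m*n≢0 2 n {{_}} {{>-nonZero 1≤n}}}} ⟩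
    1 + ⌊log₂ (2 * n) ⌋       ≡⟨ cong (1 +_) (⌊log₂[2*b]⌋≡1+⌊log₂b⌋ n {{>-nonZero 1≤n}}) ⟩
    2 + ⌊log₂ n ⌋             ≤⟨ ℕ.m≤m+n _ (⌊log₂ n ⌋ + 2 * ⌊log₂ k ⌋) ⟩
    2 + ⌊log₂ n ⌋ + (⌊log₂ n ⌋ + 2 * ⌊log₂ k ⌋) ≡⟨ collect ⌊log₂ n ⌋ ⌊log₂ k ⌋ ⟩
    2 * polylog n k           ∎
    where
    open ≤-Reasoning
    1≤2n : 1 ≤ n + n
    1≤2n = ≤-trans 1≤n (ℕ.m≤m+n n n)
    double : ∀ n → n + n + (n + n) ≡ 2 * (2 * n)
    double = solve-∀
    collect : ∀ x y → 2 + x + (x + 2 * y) ≡ 2 * (1 + x + y)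
    collect = solve-∀

  -- Since k ≥ 1 forces σ ≥ 1, M = 4 + 2 σ L is at most 8 σ Λ with Λ = `polylog n k`. Squaring and
  -- σ² ≤ k give 64 k Λ² n², and suc k ≤ 2 k adds the remaining 2 of the 66.
  phase-bound : ∀ {σ L} → σ * σ ≤ k → k < suc σ * suc σ → L ≤ 2 * polylog n k →
    moduli σ L * (moduli σ L * (n * n)) + suc k * (n * n) ≤ 66 * rate n k
  phase-bound {zero} _ k<1 _ = ⊥-elim (ℕ.<⇒≱ k<1 1≤k)
  phase-bound {σ@(suc _)} {L} σ²≤k _ L≤ = begin
    M * (M * (n * n)) + suc k * (n * n)
      ≤⟨ +-mono-≤ (*-mono-≤ M≤ (*-monoˡ-≤ (n * n) M≤)) (*-monoˡ-≤ (n * n) (+-monoˡ-≤ k 1≤k)) ⟩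
    8 * (σ * Λ) * (8 * (σ * Λ) * (n * n)) + (k + k) * (n * n)
      ≡⟨ cong₂ _+_ (regroup 8 σ Λ n) (double k n) ⟩
    64 * (σ * σ * (Λ ^ 2 * (n * n))) + 2 * (k * (n * n))
      ≤⟨ +-mono-≤ (*-monoʳ-≤ 64 (*-monoˡ-≤ (Λ ^ 2 * (n * n)) σ²≤k)) (*-monoʳ-≤ 2 (kn²≤rate n k)) ⟩
    64 * (k * (Λ ^ 2 * (n * n))) + 2 * rate n k
      ≤⟨ +-monoˡ-≤ (2 * rate n k) (*-monoʳ-≤ 64 (≤-trans (≤-reflexive (shuffle (Λ ^ 2) k n))
           (*-monoʳ-≤ (Λ ^ 2) (ℕ.m≤n⊔m 1 (k * n ^ 2))))) ⟩
    64 * rate n k + 2 * rate n k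
      ≡⟨ ℕ.*-distribʳ-+ (rate n k) 64 2 ⟨
    66 * rate n k ∎
    where
    open ≤-Reasoning
    Λ = polylog n k
    M = moduli σ L
    expand : ∀ y → 2 + (suc y + suc y) ≡ 4 + 2 * y
    expand = solve-∀
    merge : ∀ σ Λ → 4 * (σ * Λ) + 2 * (σ * (2 * Λ)) ≡ 8 * (σ * Λ)
    merge = solve-∀
    M≤ : M ≤ 8 * (σ * Λ)
    M≤ = ≤-trans (≤-reflexive (expand (σ * L)))
      (≤-trans (+-mono-≤ (*-monoʳ-≤ 4 {1} {σ * Λ} (s≤s z≤n)) (*-monoʳ-≤ 2 (*-monoʳ-≤ σ L≤))) (≤-reflexive (merge σ Λ)))
    regroup : ∀ c σ Λ n → c * (σ * Λ) * (c * (σ * Λ) * (n * n)) ≡ c * c * (σ * σ * (Λ * (Λ * 1) * (n * n)))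
    regroup = solve-∀
    double : ∀ k n → (k + k) * (n * n) ≡ 2 * (k * (n * n))
    double = solve-∀
    shuffle : ∀ x k n → k * (x * (n * n)) ≡ x * (k * (n * (n * 1)))
    shuffle = solve-∀

-- Copying, the logarithm, the number of moduli, and the report.

module Auxiliary {r ℓ} (R : Ring r ℓ) (_≟_ : Decidable (Ring._≈_ R)) (n : ℕ) (1≤n : 1 ≤ n) where

  open Algebraic R _≟_ using (mismatch)
  open Machine R _≟_

  run-copyMatrix : ∀ {s} → vars s 0 ≡ n →
    Run copyMatrix s 30 (n * n) (λ s′ → ∀ i j → i < n → j < n → rings s′ 3 i j ≡ rings s 2 i j)
  run-copyMatrix {s} n= =
    run-post (λ _ _ h i j i<n → h i i<n j)
    (run-const 30 (≤ᵇ⇒≤ _ _ _)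
    (run-for (λ i′ s′ → ∀ i → i < i′ → ∀ j → j < n → rings s′ 3 i j ≡ rings s 2 i j) n= 1≤n 1≤n (λ _ ())
    λ i s₁ i<n F₁ i= h₁ → run-post (λ s₂ _ (old , new) _ → snoc s₂ old new)
      (run-grow n (≤-reflexive (ℕ.*-identityʳ n))
      (run-for (λ j′ s′ → (∀ i′ → i′ < i → ∀ j → j < n → rings s′ 3 i′ j ≡ rings s 2 i′ j) ×
                          (∀ j → j < j′ → rings s′ 3 i j ≡ rings s 2 i j))
        (≡.trans (var= F₁ 0) n=) 1≤n (s≤s z≤n) (h₁ , λ _ ())
      λ j s₂ j<n F₂ j= (old , new) → run-ring (s≤s z≤n) λ _ →
        (λ i′ i′<i j′ j′<n → ≡.trans
          (updateArr-row (rings s₂) 3 (vars s₂ 9) (vars s₂ 10) _ 3 i′ j′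
            (λ eq → <⇒≢ i′<i (≡.trans eq (≡.trans (var= F₂ 9) i=)))) (old i′ i′<i j′ j′<n)) ,
        written s₂ i j (≡.trans (var= F₂ 9) i=) j= (≡.trans (ring= F₂ 2 _ _) (ring= F₁ 2 _ _)) new))))
    where
    snoc : ∀ s′ {i} → (∀ i′ → i′ < i → ∀ j → j < n → rings s′ 3 i′ j ≡ rings s 2 i′ j) →
      (∀ j → j < n → rings s′ 3 i j ≡ rings s 2 i j) →
      ∀ i′ → i′ < suc i → ∀ j → j < n → rings s′ 3 i′ j ≡ rings s 2 i′ j
    snoc s′ old new i′ i′<1+i with m≤n⇒m<n∨m≡n (s≤s⁻¹ i′<1+i)
    ... | inj₁ i′<i = old i′ i′<i
    ... | inj₂ ≡.refl = new
    written : ∀ s₂ i j → vars s₂ 9 ≡ i → vars s₂ 10 ≡ j → rings s₂ 2 i j ≡ rings s 2 i j →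
      (∀ j′ → j′ < j → rings s₂ 3 i j′ ≡ rings s 2 i j′) → ∀ j′ → j′ < suc j →
      updateArr (rings s₂) 3 (vars s₂ 9) (vars s₂ 10) (rings s₂ 2 (vars s₂ 9) (vars s₂ 10)) 3 i j′ ≡ rings s 2 i j′
    written s₂ i j ≡.refl ≡.refl eq new j′ j′<1+j with m≤n⇒m<n∨m≡n (s≤s⁻¹ j′<1+j)
    ... | inj₁ j′<j = ≡.trans (updateArr-column (rings s₂) 3 i j _ 3 i j′ (<⇒≢ j′<j)) (new j′ j′<j)
    ... | inj₂ ≡.refl = ≡.trans (updateArr-same (rings s₂) 3 i j _) eq

  run-computeLog : ∀ {s} → vars s 0 ≡ n →
    Run computeLog s 40 n (λ s′ → n ≤ 2 ^ vars s′ 3 × 2 ^ vars s′ 3 ≤ 1 + (n + n))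
  run-computeLog {s} n= =
    run-const 40 (≤ᵇ⇒≤ _ _ _)
    (run-seq {Q = λ s′ → vars s′ 3 ≡ 0} (run-var 1≤n ≡.refl)
    λ s₁ F₁ h₁ → run-seq {Q = λ s′ → vars s′ 3 ≡ 0 × vars s′ 4 ≡ 1} (run-var 1≤n (h₁ , ≡.refl))
    λ s₂ F₂ (h₂ , h₃) → run-post (λ _ _ → proj₂) (run-grow n (≤-reflexive (ℕ.*-identityʳ n))
      -- One doubling per round is enough, because i ≤ 2 ^ L implies i + 1 ≤ 2 ^ (L + 1). The 1 in
      -- the upper bound accounts for 2 ^ 0 at i = 0.
      (run-for (λ i s′ → vars s′ 4 ≡ 2 ^ vars s′ 3 × i ≤ 2 ^ vars s′ 3 × 2 ^ vars s′ 3 ≤ 1 + (i + i))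
        (≡.trans (var= F₂ 0) (≡.trans (var= F₁ 0) n=)) 1≤n (s≤s z≤n)
        (≡.trans h₃ (cong (2 ^_) (≡.sym h₂)) , z≤n , ≤-reflexive (cong (2 ^_) h₂))
      λ i s₃ i<n F₃ i= (p= , lo , hi) → run-if (s≤s z≤n)
        (λ t → run-seq {Q = λ s₄ → vars s₄ 4 ≡ 2 ^ vars s₃ 3 + 2 ^ vars s₃ 3} (run-var (s≤s z≤n) (cong₂ _+_ p= p=))
          λ s₄ F₄ h₄ → run-var (s≤s z≤n) λ _ → doubled s₄ (var= F₄ 3) h₄ lo (small s₃ i= p= t))
        (λ t → run-const 8 z≤n (run-skip λ _ → p= , large s₃ i= p= t ,
          ≤-trans hi (s≤s (+-mono-≤ (ℕ.n≤1+n i) (ℕ.n≤1+n i))))))))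
    where
    small : ∀ s {i p} → vars s 9 ≡ i → vars s 4 ≡ p → (vars s 4 <ᵇ vars s 9 + 1) ≡ true → p ≤ i
    small s ≡.refl ≡.refl t = s≤s⁻¹ (≤-trans (<ᵇ-true {vars s 4} t) (≤-reflexive (ℕ.+-comm (vars s 9) 1)))
    large : ∀ s {i p} → vars s 9 ≡ i → vars s 4 ≡ p → (vars s 4 <ᵇ vars s 9 + 1) ≡ false → suc i ≤ p
    large s ≡.refl ≡.refl t = ≤-trans (≤-reflexive (ℕ.+-comm 1 (vars s 9))) (<ᵇ-false {vars s 4} t)
    doubled : ∀ s {i L} → vars s 3 ≡ L → vars s 4 ≡ 2 ^ L + 2 ^ L → i ≤ 2 ^ L → 2 ^ L ≤ i →
      vars s 4 ≡ 2 ^ (vars s 3 + 1) × suc i ≤ 2 ^ (vars s 3 + 1) × 2 ^ (vars s 3 + 1) ≤ 1 + (suc i + suc i)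
    doubled s {i} ≡.refl p= lo hi =
      ≡.trans p= (≡.sym double) ,
      ≤-trans (+-mono-≤ (ℕ.m^n>0 2 (vars s 3)) lo) (≤-reflexive (≡.sym double)) ,
      ≤-trans (≤-reflexive double) (≤-trans (+-mono-≤ hi hi)
        (≤-trans (+-mono-≤ (ℕ.n≤1+n i) (ℕ.n≤1+n i)) (ℕ.n≤1+n _)))
      where
      double : 2 ^ (vars s 3 + 1) ≡ 2 ^ vars s 3 + 2 ^ vars s 3
      double = ≡.trans (cong (2 ^_) (ℕ.+-comm (vars s 3) 1)) (cong (2 ^ vars s 3 +_) (ℕ.+-identityʳ _))

  run-computeModuli : ∀ {s k L} → 1 ≤ k → vars s 1 ≡ k → vars s 3 ≡ L →
    Run computeModuli s 50 k (λ s′ → ∃[ σ ] vars s′ 5 ≡ moduli σ L × σ * σ ≤ k × k < suc σ * suc σ)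
  run-computeModuli {s} {k} {L} 1≤k k= L= =
    run-const 50 (≤ᵇ⇒≤ _ _ _)
    (run-seq {Q = λ s′ → vars s′ 4 ≡ 1} (run-var 1≤k ≡.refl)
    λ s₁ F₁ h₁ → run-seq {Q = λ s′ → vars s′ 4 ≡ 1 × vars s′ 6 ≡ 3} (run-var 1≤k (h₁ , ≡.refl))
    λ s₂ F₂ (h₂ , h₂′) → run-seq {Q = λ s′ → vars s′ 4 ≡ 1 × vars s′ 6 ≡ 3 × vars s′ 5 ≡ 4} (run-var 1≤k (h₂ , h₂′ , ≡.refl))
    λ s₃ F₃ (h₃ , h₃′ , h₃″) → run-post (λ s′ _ (σ , _ , _ , M= , lo , hi) → σ , M= , lo , hi)
      (run-grow k (≤-reflexive (ℕ.*-identityʳ k))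
      -- 2 σ + 3 is the gap between (σ + 1)² and (σ + 2)², so squares are updated by addition; σ
      -- grows by at most one per round because i < (σ + 1)² implies i + 1 < (σ + 2)².
      (run-for (λ i s′ → ∃[ σ ] vars s′ 4 ≡ suc σ * suc σ × vars s′ 6 ≡ σ + σ + 3 ×
                  vars s′ 5 ≡ moduli σ L × σ * σ ≤ i × i < suc σ * suc σ)
        (≡.trans (var= F₃ 1) (≡.trans (var= F₂ 1) (≡.trans (var= F₁ 1) k=))) 1≤k (s≤s z≤n)
        (0 , h₃ , h₃′ , h₃″ , z≤n , s≤s z≤n)
      λ i s₄ i<k F₄ i= (σ , sq= , odd= , M= , lo , hi) → run-if (s≤s z≤n)
        (λ t → run-const 14 z≤n (run-skip λ _ → σ , sq= , odd= , M= , ℕ.m≤n⇒m≤1+n lo , below s₄ i= sq= t))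
        (λ t → run-seq {Q = λ s₅ → vars s₅ 4 ≡ suc σ * suc σ + (σ + σ + 3)} (run-var (s≤s z≤n) (cong₂ _+_ sq= odd=))
          λ s₅ F₅ h₅ → run-seq {Q = λ s₆ → vars s₆ 6 ≡ σ + σ + 3 + 2}
            (run-var (s≤s z≤n) (cong (_+ 2) (≡.trans (var= F₅ 6) odd=)))
          λ s₆ F₆ h₆ → run-var (s≤s z≤n) λ _ →
            suc σ , ≡.trans (var= F₆ 4) (≡.trans h₅ (square σ)) , ≡.trans h₆ (odd σ) ,
            ≡.trans (cong₂ (λ x y → x + (y + y)) (≡.trans (var= F₆ 5) (≡.trans (var= F₅ 5) M=))
              (≡.trans (var= F₆ 3) (≡.trans (var= F₅ 3) (≡.trans (var= F₄ 3)
                (≡.trans (var= F₃ 3) (≡.trans (var= F₂ 3) (≡.trans (var= F₁ 3) L=))))))) (moduli-suc σ L) ,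
            above s₄ i= sq= t ,
            ≤-trans (s≤s hi) (≤-trans (s≤s (ℕ.m≤m+n (suc σ * suc σ) (σ + σ + 2))) (≤-reflexive (square′ σ)))))))
    where
    below : ∀ s {i q} → vars s 9 ≡ i → vars s 4 ≡ q → (vars s 9 + 1 <ᵇ vars s 4) ≡ true → suc i < q
    below s ≡.refl ≡.refl t = ≤-trans (s≤s (≤-reflexive (ℕ.+-comm 1 (vars s 9)))) (<ᵇ-true {vars s 9 + 1} t)
    above : ∀ s {i q} → vars s 9 ≡ i → vars s 4 ≡ q → (vars s 9 + 1 <ᵇ vars s 4) ≡ false → q ≤ suc i
    above s ≡.refl ≡.refl t = ≤-trans (<ᵇ-false {vars s 9 + 1} t) (≤-reflexive (ℕ.+-comm (vars s 9) 1))
    square : ∀ σ → suc σ * suc σ + (σ + σ + 3) ≡ suc (suc σ) * suc (suc σ)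
    square = solve-∀
    square′ : ∀ σ → suc (suc σ * suc σ + (σ + σ + 2)) ≡ suc (suc σ) * suc (suc σ)
    square′ = solve-∀
    odd : ∀ σ → σ + σ + 3 + 2 ≡ suc σ + suc σ + 3
    odd = solve-∀
    moduli-suc : ∀ σ L → 2 + (suc (σ * L) + suc (σ * L)) + (L + L) ≡ 2 + (suc (suc σ * L) + suc (suc σ * L))
    moduli-suc = solve-∀

  reported-snoc : ∀ s s′ {i j} → vars s′ 2 ≡ suc (vars s 2) →
    (∀ l q → l < vars s 2 → ints s′ 0 l q ≡ ints s 0 l q) →
    ints s′ 0 (vars s 2) 0 ≡ i → ints s′ 0 (vars s 2) 1 ≡ j →
    reported s′ ≡ reported s ++ [ i , j ]
  reported-snoc s s′ {i} {j} c= old i= j= = begin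
    map f′ (upTo (vars s′ 2))                ≡⟨ cong (map f′ ∘ upTo) c= ⟩
    map f′ (upTo (suc (vars s 2)))           ≡⟨ map-upTo f′ (suc (vars s 2)) ⟩
    applyUpTo f′ (suc (vars s 2))            ≡⟨ applyUpTo-∷ʳ f′ (vars s 2) ⟨
    applyUpTo f′ (vars s 2) ++ [ f′ (vars s 2) ]
      ≡⟨ cong₂ (λ xs x → xs ++ [ x ])
           (applyUpTo-cong (vars s 2) (λ l l< → cong₂ _,_ (old l 0 l<) (old l 1 l<))) (cong₂ _,_ i= j=) ⟩
    applyUpTo f (vars s 2) ++ [ i , j ]      ≡⟨ cong (_++ [ i , j ]) (map-upTo f (vars s 2)) ⟨
    map f (upTo (vars s 2)) ++ [ i , j ]     ∎
    where
    open ≡.≡-Reasoning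
    f f′ : ℕ → ℕ × ℕ
    f l = ints s 0 l 0 , ints s 0 l 1
    f′ l = ints s′ 0 l 0 , ints s′ 0 l 1

  run-report : ∀ {s} → vars s 0 ≡ n → vars s 2 ≡ 0 →
    Run report s 60 (n * n)
      (λ s′ → reported s′ ≡ matList (λ i j → mismatch (rings s 3 i j) (rings s 2 i j)) n n)
  run-report {s} n= c= =
    run-const 60 (≤ᵇ⇒≤ _ _ _)
    (run-for (λ i s′ → reported s′ ≡ matList d n i) n= 1≤n 1≤n (cong (λ c → map _ (upTo c)) c=)
    λ i s₁ i<n F₁ i= h₁ → run-post (λ _ _ h _ → h)
      (run-grow n (≤-reflexive (ℕ.*-identityʳ n))
      (run-for (λ j s′ → reported s′ ≡ matList d n i ++ rowList d i j)
        (≡.trans (var= F₁ 0) n=) 1≤n (s≤s z≤n) (≡.trans h₁ (≡.sym (++-identityʳ _)))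
      λ j s₂ j<n F₂ j= h₂ →
        compareEntry s₂ i j (≡.trans (var= F₂ 9) i=) j=
          (≡.trans (ring= F₂ 3 _ _) (ring= F₁ 3 _ _)) (≡.trans (ring= F₂ 2 _ _) (ring= F₁ 2 _ _)) h₂)))
    where
    d : ℕ → ℕ → ℕ
    d i j = mismatch (rings s 3 i j) (rings s 2 i j)
    compareEntry : ∀ s₂ i j → vars s₂ 9 ≡ i → vars s₂ 10 ≡ j →
      rings s₂ 3 i j ≡ rings s 3 i j → rings s₂ 2 i j ≡ rings s 2 i j →
      reported s₂ ≡ matList d n i ++ rowList d i j →
      Run (If ring 3 [ var 9 , var 10 ] ≈' ring 2 [ var 9 , var 10 ] Then skip Else (
             int 0 [ var 2 , lit 0 ]≔ var 9 ︔ int 0 [ var 2 , lit 1 ]≔ var 10 ︔ 2 ≔ var 2 ⊕ lit 1)) s₂ 19 1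
        (λ s′ → ℕ → reported s′ ≡ matList d n i ++ rowList d i (suc j))
    compareEntry s₂ i j ≡.refl ≡.refl p q h = run-if (s≤s z≤n)
      (λ t → run-const 12 z≤n (run-skip λ _ →
        ≡.trans h (extend (≡.sym (++-identityʳ _)) (outcome t))))
      (λ t → ran (⇓seq ⇓int (⇓seq ⇓int ⇓var)) ≤-refl λ _ →
        ≡.trans (reported-snoc s₂ (setVar 2 (c + 1) (state (vars s₂) (updateArr ints₁ 0 c 1 j) (rings s₂))) (ℕ.+-comm c 1)
          (λ l x l<c → ≡.trans (updateArr-row ints₁ 0 c 1 j 0 l x (<⇒≢ l<c))
                               (updateArr-row (ints s₂) 0 c 0 i 0 l x (<⇒≢ l<c)))
          (≡.trans (updateArr-column ints₁ 0 c 1 j 0 c 0 λ ()) (updateArr-same (ints s₂) 0 c 0 i))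
          (updateArr-same ints₁ 0 c 1 j))
        (≡.trans (cong (_++ [ i , j ]) h) (extend ≡.refl (outcome t))))
      where
      c = vars s₂ 2
      ints₁ = updateArr (ints s₂) 0 c 0 i
      outcome : ∀ {t} → does (rings s₂ 3 i j ≟ rings s₂ 2 i j) ≡ t → d i j ≡ (if t then 0 else 1)
      outcome t rewrite ≡.sym p | ≡.sym q | t = ≡.refl
      extend : ∀ {e ys} → ys ≡ (matList d n i ++ rowList d i j) ++ pick e (i , j) → d i j ≡ e →
        ys ≡ matList d n i ++ rowList d i (suc j)
      extend {e} eq ≡.refl = ≡.trans eq (++-assoc (matList d n i) (rowList d i j) (pick e (i , j)))

-- Joining the row phase and the column phase.

module Assembly {r ℓ} (R : Ring r ℓ) (_≟_ : Decidable (Ring._≈_ R)) where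

  open Ring R using (Carrier; _≈_; refl; sym; trans; reflexive)
  open Algebraic R _≟_
  open Machine R _≟_

  module _ (n k : ℕ) (1≤n : 1 ≤ n) (1≤k : 1 ≤ k) where

    open Auxiliary R _≟_ n 1≤n

    module _ (a b z₀ : ℕ → ℕ → Carrier) where

      open Correction R _≟_ n 1≤n a b

      errors₀ : ℕ → ℕ → ℕ
      errors₀ i j = mismatch (z₀ i j) (prod true i j)

      module _ {σ L} (n≤2^L : n ≤ 2 ^ L) (k<[1+σ]² : k < suc σ * suc σ)
        (few : sumᴺ n (λ i → sumᴺ n (errors₀ i)) ≤ k) (s : State)
        (corrected : ∀ i → i < n → Corrected true (moduli σ L) (s≤s z≤n) z₀ s i) where

        errors₁ : ℕ → ℕ → ℕ
        errors₁ i j = mismatch (rings s 2 i j) (prod true i j)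

        -- The first phase creates no errors: a row is either recomputed correctly or left alone.
        -- Hence the second phase again starts from at most k errors.
        errors₁≤errors₀ : ∀ i j → i < n → j < n → errors₁ i j ≤ errors₀ i j
        errors₁≤errors₀ i j i<n j<n with corrected i i<n
        ... | inj₁ row = ≤-trans (≤-reflexive (≈⇒mismatch≡0 (row j j<n))) z≤n
        ... | inj₂ (same , _) = ≤-reflexive (cong (λ x → mismatch x (prod true i j)) (same j))

        -- Only rows with more than σ original errors stay wrong, phrased through the 0-1 indicator
        -- so that `few-heavy` can sum it down a column.
        wrong⇒heavy : ∀ i j → i < n → j < n → suc σ * errors₁ i j ≤ sumᴺ n (errors₀ i)
        wrong⇒heavy i j i<n j<n with corrected i i<n | sumᴺ n (errors₀ i) ≤? σ
        ... | inj₁ row | _ = ≤-trans (*-monoʳ-≤ (suc σ) (≤-reflexive (≈⇒mismatch≡0 (row j j<n))))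
              (≤-trans (≤-reflexive (ℕ.*-zeroʳ (suc σ))) z≤n)
        ... | inj₂ _ | no heavy = ≤-trans (*-monoʳ-≤ (suc σ) (mismatch-≤1 _ _))
              (≤-trans (≤-reflexive (ℕ.*-identityʳ (suc σ))) (ℕ.≰⇒> heavy))
        ... | inj₂ (same , passes) | yes light = ≤-trans (*-monoʳ-≤ (suc σ) (≤-reflexive (≈⇒mismatch≡0
              (trans (reflexive (same j))
                (Oriented.light-row-correct true n L σ (z₀ i) (prod true i) n≤2^L passes light j j<n)))))
              (≤-trans (≤-reflexive (ℕ.*-zeroʳ (suc σ))) z≤n)

        -- Both orientations describe the same data definitionally: `Z false s j i` is the entry (i,
        -- j) of the stored matrix, and `prod false j i` unfolds to `prod true i j`, as
        -- transposition and the opposite product cancel.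
        column-light : ∀ j → j < n → errors false (Z false s) j ≤ σ
        column-light j j<n = few-heavy n σ k (λ i → errors₁ i j) (λ i → sumᴺ n (errors₀ i))
          (λ i i<n → wrong⇒heavy i j i<n j<n) few k<[1+σ]²

        few-left : sumᴺ n (errors false (Z false s)) ≤ k
        few-left = ≤-trans (≤-reflexive (sumᴺ-comm n n (λ j i → errors₁ i j)))
          (≤-trans (sumᴺ-mono n (λ i i<n → sumᴺ-mono n (λ j j<n → errors₁≤errors₀ i j i<n j<n))) few)

        all-correct : ∀ s′ → (∀ j → j < n → Corrected false (moduli σ L) (s≤s z≤n) (Z false s) s′ j) →
          ∀ i j → i < n → j < n → rings s′ 2 i j ≈ prod true i j
        all-correct s′ corrected′ i j i<n j<n with corrected′ j j<n
        ... | inj₁ column = column i i<n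
        ... | inj₂ (same , passes) = trans (reflexive (same i))
          (Oriented.light-row-correct false n L σ (Z false s j) (prod false j) n≤2^L passes (column-light j j<n) i i<n)

      run-correct : ∀ σ L {s} → n ≤ 2 ^ L → k < suc σ * suc σ →
        sumᴺ n (λ i → sumᴺ n (errors₀ i)) ≤ k → Base s → vars s 5 ≡ moduli σ L →
        (∀ i j → rings s 2 i j ≡ z₀ i j) → (∀ a i j → ints s a i j ≡ 0) →
        Run correct s 538 (moduli σ L * (moduli σ L * (n * n)) + suc k * (n * n))
          (λ s′ → ∀ i j → i < n → j < n → rings s′ 2 i j ≈ prod true i j)
      run-correct σ L {s} n≤2^L k< few base M= z= marks = run-seq
        (run-phase true (moduli σ L) (s≤s z≤n) z₀ k few base M= z= (λ i _ → marks 1 0 i))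
        λ s₁ F₁ rows → run-post (λ s₂ _ → all-correct {σ} {L} n≤2^L k< few s₁ rows s₂)
        (run-phase false (moduli σ L) (s≤s z≤n) (Z false s₁) k (few-left {σ} {L} n≤2^L k< few s₁ rows)
          (base-frame F₁ base) (≡.trans (var= F₁ 5) M=) (λ _ _ → ≡.refl)
          (λ i _ → ≡.trans (int= F₁ 2 0 i) (marks 2 0 i)))

      -- `W` is a common growth rate for all stages, so their constants simply add: 30 + 40 + 50 +
      -- 538 + 60 = 718.
      run-main : ∀ {s} W → n * n ≤ W → k ≤ W →
        (∀ σ L → σ * σ ≤ k → k < suc σ * suc σ → L ≤ 2 * polylog n k →
          moduli σ L * (moduli σ L * (n * n)) + suc k * (n * n) ≤ W) →
        sumᴺ n (λ i → sumᴺ n (errors₀ i)) ≤ k → vars s 1 ≡ k → vars s 2 ≡ 0 → Base s →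
        (∀ i j → rings s 2 i j ≡ z₀ i j) → (∀ a i j → ints s a i j ≡ 0) →
        Run (copyMatrix ︔ computeLog ︔ computeModuli ︔ correct ︔ report) s 718 W
          (λ s′ → (∃[ d ] reported s′ ≡ matList d n n × (∀ i j → i < n → j < n → d i j ≡ errors₀ i j)) ×
                  (∀ i j → i < n → j < n → rings s′ 2 i j ≈ prod true i j))
      run-main {s} W n²≤W k≤W phases≤W few k= c= base z= zeros =
        run-seq {c = 30} (run-grow W n²≤W (run-copyMatrix (proj₁ base)))
        λ s₁ F₁ copied → run-seq {c = 40} (run-grow W (≤-trans (c≤c*p 1≤n) n²≤W) (run-computeLog (≡.trans (var= F₁ 0) (proj₁ base))))
        λ s₂ F₂ (n≤2^L , 2^L≤) → run-seq {c = 50}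
          (run-grow W k≤W (run-computeModuli {L = vars s₂ 3} 1≤k (≡.trans (var= F₂ 1) (≡.trans (var= F₁ 1) k=)) ≡.refl))
        λ s₃ F₃ (σ , M= , σ²≤k , k<) → run-seq {c = 538}
          (run-grow W (phases≤W σ (vars s₂ 3) σ²≤k k< (log-bound 1≤n 1≤k 2^L≤))
            (run-correct σ (vars s₂ 3) n≤2^L k< few (base-frame F₃ (base-frame F₂ (base-frame F₁ base))) M=
              (λ i j → ≡.trans (ring= F₃ 2 i j) (≡.trans (ring= F₂ 2 i j) (≡.trans (ring= F₁ 2 i j) (z= i j))))
              (λ a i j → ≡.trans (int= F₃ a i j) (≡.trans (int= F₂ a i j) (≡.trans (int= F₁ a i j) (zeros a i j))))))
        λ s₄ F₄ right → run-post
          -- The report compares the copy of C′ with the corrected matrix; as the latter equals the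
          -- product up to ≈, the indicator coincides with that of the original errors.
          (λ s₅ F₅ rep → (_ , rep , λ i j i<n j<n → mismatch-cong
              (reflexive (≡.trans (ring= F₄ 3 i j) (≡.trans (ring= F₃ 3 i j) (≡.trans (ring= F₂ 3 i j)
                (≡.trans (copied i j i<n j<n) (z= i j)))))) (right i j i<n j<n)) ,
            λ i j i<n j<n → trans (reflexive (ring= F₅ 2 i j)) (right i j i<n j<n))
          (run-grow W n²≤W (run-report
            (≡.trans (var= F₄ 0) (≡.trans (var= F₃ 0) (≡.trans (var= F₂ 0) (≡.trans (var= F₁ 0) (proj₁ base)))))
            (≡.trans (var= F₄ 2) (≡.trans (var= F₃ 2) (≡.trans (var= F₂ 2) (≡.trans (var= F₁ 2) c=))))))

-- From the machine's matrices to `Matrix n`, with the degenerate inputs.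

module _ {r ℓ} (R : Ring r ℓ) (_≟_ : Decidable (Ring._≈_ R)) where

  open Ring R using (_≈_; refl; trans; reflexive)
  open Algebraic R _≟_
  open Machine R _≟_

  no-differences : ∀ {n} (M N : Matrix n) → differences M N ≡ [] → ∀ i j → M i j ≈ N i j
  no-differences {n} M N none i j with M i j ≟ N i j
  ... | yes M≈N = M≈N
  ... | no M≉N with subst ((i , j) ∈_) none (∈-filter⁺ (λ (i , j) → ¬? (M i j ≟ N i j))
                      (∈-cartesianProduct⁺ (∈-allFin i) (∈-allFin j)) M≉N)
  ...   | ()

  Solved : ∀ {n} (A B C′ : Matrix n) → State → Set ℓ
  Solved A B C′ s = Reports s (differences C′ (A ⊗ B)) × HoldsMatrix s (A ⊗ B)

  already-solved : ∀ {n} k (A B C′ : Matrix n) → differences C′ (A ⊗ B) ≡ [] → Solved A B C′ (input k A B C′)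
  already-solved k A B C′ none =
    ↭-reflexive (cong (map _) (≡.sym none)) ,
    λ i j → trans (reflexive (entry-toℕ C′ i j)) (no-differences C′ (A ⊗ B) none i j)

  -- The two zero tests cost 3 each on top of 718. For n = 0 the list of differences computes to the
  -- empty list, and for k = 0 it is empty because its length is at most k.
  run-program : ∀ n k (A B C′ : Matrix n) → length (differences C′ (A ⊗ B)) ≤ k →
    ∀ W → 66 * rate n k ≤ W → Run main (input k A B C′) 724 W (Solved A B C′)
  run-program zero k A B C′ _ W rate≤W = run-if (≤-trans (≤-trans (1≤rate zero k) (ℕ.m≤m+n _ _)) rate≤W)
    (λ _ → run-const 721 z≤n (run-skip (already-solved k A B C′ ≡.refl))) (λ ())
  run-program n@(suc _) zero A B C′ few W rate≤W = run-if 1≤W (λ ())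
    (λ _ → run-if 1≤W (λ _ → run-const 718 z≤n (run-skip (already-solved 0 A B C′ (empty _ few)))) (λ ()))
    where
    1≤W : 1 ≤ W
    1≤W = ≤-trans (≤-trans (1≤rate n zero) (ℕ.m≤m+n _ _)) rate≤W
    empty : ∀ {a} {X : Set a} (xs : List X) → length xs ≤ 0 → xs ≡ []
    empty [] _ = ≡.refl
  run-program n@(suc _) k@(suc _) A B C′ few W rate≤W = run-if 1≤W (λ ()) λ _ → run-if 1≤W (λ ()) λ _ →
    run-post solved (run-main n k 1≤n 1≤k (entry A) (entry B) (entry C′) W
      (≤-trans (n²≤rate 1≤n 1≤k) rate≤W′) (≤-trans (k≤rate 1≤n 1≤k) rate≤W′)
      (λ σ L σ²≤k k< L≤ → ≤-trans (phase-bound 1≤n 1≤k {σ} {L} σ²≤k k< L≤) rate≤W)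
      ∑errors≤k ≡.refl ≡.refl (≡.refl , (λ _ _ → ≡.refl) , λ _ _ → ≡.refl) (λ _ _ → ≡.refl) (λ _ _ _ → ≡.refl))
    where
    open Assembly R _≟_
    1≤n : 1 ≤ n
    1≤n = s≤s z≤n
    1≤k : 1 ≤ k
    1≤k = s≤s z≤n
    open Correction R _≟_ n 1≤n (entry A) (entry B) using (prod)
    rate≤W′ : rate n k ≤ W
    rate≤W′ = ≤-trans (ℕ.m≤m+n _ _) rate≤W
    1≤W : 1 ≤ W
    1≤W = ≤-trans (1≤rate n k) rate≤W′
    d₀ : ℕ → ℕ → ℕ
    d₀ i j = mismatch (entry C′ i j) (prod true i j)
    d₀-correct : ∀ i j → d₀ (toℕ i) (toℕ j) ≡ mismatch (C′ i j) ((A ⊗ B) i j)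
    d₀-correct i j = mismatch-cong (reflexive (entry-toℕ C′ i j)) (entry-⊗ A B i j)
    ∑errors≤k : sumᴺ n (λ i → sumᴺ n (d₀ i)) ≤ k
    ∑errors≤k = begin
      sumᴺ n (λ i → sumᴺ n (d₀ i))          ≤⟨ length-matList d₀ n n (λ i j → mismatch-≤1 _ _) ⟩
      length (matList d₀ n n)               ≡⟨ cong length (differences-matList C′ (A ⊗ B) d₀ d₀-correct) ⟨
      length (map _ (differences C′ (A ⊗ B)))  ≡⟨ length-map _ (differences C′ (A ⊗ B)) ⟩
      length (differences C′ (A ⊗ B))       ≤⟨ few ⟩
      k                                     ∎
      where open ≤-Reasoning
    solved : ∀ s → Frame _ (input k A B C′) s →
      (∃[ d ] reported s ≡ matList d n n × (∀ i j → i < n → j < n → d i j ≡ d₀ i j)) ×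
      (∀ i j → i < n → j < n → rings s 2 i j ≈ prod true i j) → Solved A B C′ s
    solved s _ ((d , rep , d=) , right) =
      ↭-reflexive (≡.trans rep (≡.sym (differences-matList C′ (A ⊗ B) d
        (λ i j → ≡.trans (d= (toℕ i) (toℕ j) (toℕ<n i) (toℕ<n j)) (d₀-correct i j))))) ,
      λ i j → trans (right (toℕ i) (toℕ j) (toℕ<n i) (toℕ<n j)) (entry-⊗ A B i j)

theorem2 : ∀ {r ℓ} (R : Ring r ℓ) (_≟_ : Decidable (Ring._≈_ R)) →
    let open OverRing R _≟_ in
    ∃[ P ] ∃[ T ] (T ∈Õ λ n k → k * n ^ 2) ×
    (∀ (n k : ℕ) (A B C′ : Matrix n) →
    length (differences C′ (A ⊗ B)) ≤ k →
    ∃[ t ] ∃[ s ] (P ⊢ input k A B C′ ⇓[ t ] s) × t ≤ T n k ×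
    Reports s (differences C′ (A ⊗ B)) × HoldsMatrix s (A ⊗ B))
theorem2 R _≟_ =
  -- 724 counts the unit costs of the program and 66 comes from `phase-bound`. The exponent 2 arises
  -- because M carries one logarithmic factor and enters squared.
  main , (λ n k → 724 * (66 * rate n k)) ,
  (724 * 66 , 2 , λ n k → ≤-reflexive (regroup 724 66 (polylog n k ^ 2) (1 ⊔ k * n ^ 2))) ,
  λ n k A B C′ few → let run = run-program R _≟_ n k A B C′ few (66 * rate n k) ≤-refl in
    _ , _ , Run.steps run , Run.bound run , Run.post run
  where
  open Machine R _≟_ using (module Run)
  regroup : ∀ c d x y → c * (d * (x * y)) ≡ c * d * x * y
  regroup = solve-∀
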